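{- Let $\pi\in S_n$ be such that $G(\pi)=G=(V,E)$ has only trivial modules, with $V$ being a prime node in the modular decomposition of $G$. Then $[\pi]$ is a multiset of the form \[ \Big\{\pi,\ \pi^{ -1},\ ((\pi^c)^{ -1})^c,\ (((\pi^c)^{ -1})^c)^{ -1}\Big\} \] (that is, the elements of the geo-equivalence class $[\pi]$ are exactly these four permutations, not necessarily distinct), which may contain four, two or one distinct permutation(s). Moreover, this is the only geo-equivalence class of $S_n$ represented by a transitive orientation of $G$.
   Context: Inversion set: $E(\pi)=\{(i,j):1\le i<j\le n,\ \pi^{ -1}(i)>\pi^{ -1}(j)\}$. $G(\pi)$ is the graph on $\{1,\dots,n\}$ in which $i<j$ are adjacent iff $(i,j)\in E(\pi)$; $D(\pi)$ is the digraph on $\{1,\dots,n\}$ with arc set $E(\pi)$. The reverse of $\pi=\pi(1)\pi(2)\cdots\pi(n)$ is $\pi^c=\pi(n)\pi(n-1)\cdots\pi(1)$. A transitive orientation of a graph $(V,E)$ assigns exactly one direction to each edge, giving an arc set $F$, so that $(u,v),(v,w)\in F$ implies $(u,w)\in F$. A digraph $(V,F)$ represents a permutation $\sigma\in S_n$ if $(V,F)\cong D(\sigma)$; it represents the geo-equivalence class $[\sigma]$ if it represents a permutation in it. A module of $G=(V,E)$ is a set $M\subseteq V$ such that each vertex outside $M$ is adjacent to all or to none of the vertices of $M$. The trivial modules are $V$ and the singletons $\{v\}$. $V$ is a prime node in the modular decomposition of $G$ when $|V|>1$ and both $G$ and its complement $G^c$ are connected. Geo-equivalence: a geometric graph is a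 simple graph together with a straight-line drawing in the plane with vertices in general position (no three vertices collinear, no three edges crossing at a single point); two edges cross if they meet at a point interior to both. A geo-isomorphism is a vertex bijection preserving adjacency, non-adjacency, crossings and non-crossings of edges. $K_{2,n}$ has vertex set $\{a,b\}\cup\{1,\dots,n\}$. For $\pi\in S_n$, the realization $\overline{K}_{2,n}(\pi)$ is built thus: from each of two points $a,b\in\mathbb{R}^2$ draw $n$ rays, all on the same side of the line $ab$, each ray from $a$ meeting each ray from $b$ (generically, so that general position holds); label the rays from $b$ as $1,\dots,n$ in increasing order of angle with the segment $ba$, and the rays from $a$ as $\pi(1),\dots,\pi(n)$ in increasing order of angle with the segment $ab$; place vertex $i$ at the intersection of the two rays labeled $i$ and draw the segments $ai,bi$. Then $\sigma\sim\pi$ iff $\overline{K}_{2,n}(\sigma)$ and $\overline{K}_{2,n}(\pi)$ are geo-isomorphic, and $[\pi]\subseteq S_n$ is the equivalence class of $\pi$. -}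

module Defs where

open import Algebra.Bundles using (CommutativeRing)
open import Data.Fin.Base using (Fin; _<_; _>_)
import Data.Fin.Properties as Fin
open import Data.Fin.Permutation
  using (Permutation′; _⟨$⟩ʳ_; _⟨$⟩ˡ_; _∘ₚ_; reverse)
  renaming (_≈_ to _≈ₚ_)
open import Data.Fin.Subset using (Subset; Nonempty; ⊤; ⁅_⁆)
  renaming (_∈_ to _∈ₛ_; _∉_ to _∉ₛ_)
open import Data.Nat.Base as ℕ using (ℕ)
open import Data.Product.Base using (_×_; _,_; ∃; ∃₂; ∃-syntax; uncurry)
open import Data.Product.Relation.Binary.Pointwise.NonDependent using (Pointwise)
open import Data.Sum.Base using (_⊎_; inj₁; inj₂; swap)
open import Function.Base using (_∘_)
open import Function.Bundles using (_⇔_; _↔_; module Inverse)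
open import Level using (Level; 0ℓ; _⊔_) renaming (suc to lsuc)
open import Relation.Binary.Construct.Closure.ReflexiveTransitive using (Star)
open import Relation.Binary.Core using (Rel)
open import Relation.Binary.Definitions using (Symmetric; Irreflexive; Transitive)
open import Relation.Binary.PropositionalEquality.Core using (_≡_; _≢_; refl; sym)
open import Relation.Binary.Structures using (IsStrictTotalOrder)
open import Relation.Nullary.Negation.Core using (¬_)
open import Relation.Unary using (Pred; _∈_)

------------------------------------------------------------------------
-- Graphs and digraphs

record SimpleGraph (V : Set) : Set₁ where
  field
    Adj    : Rel V 0ℓ
    symm   : Symmetric Adj
    irrefl : Irreflexive _≡_ Adj

open SimpleGraph public using (Adj)

Digraph : ℕ → Set₁
Digraph n = Rel (Fin n) 0ℓ

complement : ∀ {V} → SimpleGraph V → SimpleGraph V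
complement G = record
  { Adj    = λ u v → u ≢ v × ¬ Adj G u v
  ; symm   = λ { (u≢v , ¬uv) → u≢v ∘ sym , ¬uv ∘ SimpleGraph.symm G }
  ; irrefl = λ { u≡v (u≢v , _) → u≢v u≡v }
  }

Connected : ∀ {V} → SimpleGraph V → Set
Connected G = ∀ u v → Star (Adj G) u v

-- Modules are nonempty: ∅ is not listed among the trivial modules, although it
-- would satisfy the remaining condition vacuously.
IsModule : ∀ {n} → SimpleGraph (Fin n) → Subset n → Set
IsModule G M = Nonempty M ×
  (∀ v → v ∉ₛ M → (∀ m → m ∈ₛ M → Adj G v m) ⊎ (∀ m → m ∈ₛ M → ¬ Adj G v m))

OnlyTrivialModules : ∀ {n} → SimpleGraph (Fin n) → Set
OnlyTrivialModules {n} G =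
  ∀ (M : Subset n) → IsModule G M → M ≡ ⊤ ⊎ (∃[ v ] M ≡ ⁅ v ⁆)

-- "V is a prime node in the modular decomposition of G".
IsPrimeRoot : ∀ {n} → SimpleGraph (Fin n) → Set
IsPrimeRoot {n} G = 1 ℕ.< n × Connected G × Connected (complement G)

record IsTransitiveOrientation {n} (G : SimpleGraph (Fin n)) (F : Digraph n) : Set where
  field
    arc⇒edge  : ∀ {u v} → F u v → Adj G u v
    edge⇒arc! : ∀ {u v} → Adj G u v → (F u v × ¬ F v u) ⊎ (¬ F u v × F v u)
    trans     : Transitive F

_≅ᵈ_ : ∀ {n} → Digraph n → Digraph n → Set
_≅ᵈ_ {n} F H = ∃ λ (f : Permutation′ n) →
  ∀ u v → F u v ⇔ H (f ⟨$⟩ʳ u) (f ⟨$⟩ʳ v)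

------------------------------------------------------------------------
-- Permutations

E : ∀ {n} → Permutation′ n → Digraph n
E π i j = i < j × (π ⟨$⟩ˡ i) > (π ⟨$⟩ˡ j)

D : ∀ {n} → Permutation′ n → Digraph n
D = E

G⟨_⟩ : ∀ {n} → Permutation′ n → SimpleGraph (Fin n)
G⟨ π ⟩ = record
  { Adj    = λ i j → E π i j ⊎ E π j i
  ; symm   = swap
  ; irrefl = λ { refl (inj₁ (i<i , _)) → Fin.<-irrefl refl i<i
               ; refl (inj₂ (i<i , _)) → Fin.<-irrefl refl i<i }
  }

-- π(n) … π(2) π(1); note that _∘ₚ_ composes diagrammatically.
_ᶜ : ∀ {n} → Permutation′ n → Permutation′ n
π ᶜ = reverse ∘ₚ π

infix 30 _ᶜ

_Represents_ : ∀ {n} → Digraph n → Permutation′ n → Set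
F Represents σ = F ≅ᵈ D σ

_RepresentsClass_ : ∀ {n ℓ} → Digraph n → Pred (Permutation′ n) ℓ → Set ℓ
F RepresentsClass C = ∃[ σ ] σ ∈ C × F Represents σ

-- Permutations are counted up to pointwise equality.
HasCardinality : ∀ {n ℓ} → Pred (Permutation′ n) ℓ → ℕ → Set ℓ
HasCardinality {n} C k = ∃ λ (f : Fin k → Permutation′ n) →
    (∀ i → f i ∈ C)
  × (∀ {i j} → f i ≈ₚ f j → i ≡ j)
  × (∀ σ → σ ∈ C → ∃[ i ] σ ≈ₚ f i)

------------------------------------------------------------------------
-- The complete bipartite graph K₂,ₙ

data Vertex (n : ℕ) : Set where
  a b : Vertex n
  pt  : Fin n → Vertex n

data K₂-Adj {n} : Rel (Vertex n) 0ℓ where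
  a-pt : ∀ {i} → K₂-Adj a (pt i)
  pt-a : ∀ {i} → K₂-Adj (pt i) a
  b-pt : ∀ {i} → K₂-Adj b (pt i)
  pt-b : ∀ {i} → K₂-Adj (pt i) b

K₂ : ∀ n → SimpleGraph (Vertex n)
K₂ n = record
  { Adj    = K₂-Adj
  ; symm   = λ { a-pt → pt-a ; pt-a → a-pt ; b-pt → pt-b ; pt-b → b-pt }
  ; irrefl = λ { refl () }
  }

------------------------------------------------------------------------
-- Ordered fields

-- The field of coordinates. The real numbers are the intended instance.
record OrderedField c ℓ₁ ℓ₂ : Set (lsuc (c ⊔ ℓ₁ ⊔ ℓ₂)) where
  field
    commutativeRing : CommutativeRing c ℓ₁
  open CommutativeRing commutativeRing public
  infix 4 _<ᶠ_
  field
    _<ᶠ_               : Rel Carrier ℓ₂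
    isStrictTotalOrder : IsStrictTotalOrder _≈_ _<ᶠ_
    0<1                : 0# <ᶠ 1#
    +-monoˡ-<          : ∀ {x y} z → x <ᶠ y → x + z <ᶠ y + z
    *-pos              : ∀ {x y} → 0# <ᶠ x → 0# <ᶠ y → 0# <ᶠ x * y
    inverse            : ∀ x → ¬ x ≈ 0# → ∃[ y ] x * y ≈ 1#

------------------------------------------------------------------------
-- Geometric graphs and geo-equivalence

module Geometry {c ℓ₁ ℓ₂} (𝔽 : OrderedField c ℓ₁ ℓ₂) where
  open OrderedField 𝔽 hiding (refl; sym; trans)

  Point : Set c
  Point = Carrier × Carrier

  infix  4 _≈ᵖ_
  infixl 6 _+ᵖ_ _-ᵖ_
  infixr 7 _·ᵖ_

  _≈ᵖ_ : Rel Point ℓ₁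
  _≈ᵖ_ = Pointwise _≈_ _≈_

  _+ᵖ_ _-ᵖ_ : Point → Point → Point
  (x , y) +ᵖ (x′ , y′) = x + x′ , y + y′
  (x , y) -ᵖ (x′ , y′) = x - x′ , y - y′

  _·ᵖ_ : Carrier → Point → Point
  t ·ᵖ (x , y) = t * x , t * y

  -- |u| |v| sin θ, where θ is the directed angle from u to v.
  det : Point → Point → Carrier
  det (x , y) (x′ , y′) = x * y′ - y * x′

  Collinear : Point → Point → Point → Set ℓ₁
  Collinear p q r = det (q -ᵖ p) (r -ᵖ p) ≈ 0#

  InteriorOf : Point → Point → Point → Set (c ⊔ ℓ₁ ⊔ ℓ₂)
  InteriorOf q r p =
    ∃[ t ] 0# <ᶠ t × t <ᶠ 1# × p ≈ᵖ q +ᵖ t ·ᵖ (r -ᵖ q)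

  SameEdge : ∀ {V : Set} → Rel (V × V) 0ℓ
  SameEdge (u , v) (w , x) = (u ≡ w × v ≡ x) ⊎ (u ≡ x × v ≡ w)

  record GeometricGraph {V} (G : SimpleGraph V) : Set (c ⊔ ℓ₁ ⊔ ℓ₂) where
    field
      pos : V → Point

    IsEdge : V × V → Set
    IsEdge = uncurry (Adj G)

    _InteriorToEdge_ : Point → V × V → Set (c ⊔ ℓ₁ ⊔ ℓ₂)
    p InteriorToEdge (u , v) = InteriorOf (pos u) (pos v) p

    field
      pos-injective : ∀ {u v} → pos u ≈ᵖ pos v → u ≡ v

      no-three-collinear : ∀ {u v w} → u ≢ v → v ≢ w → u ≢ w →
        ¬ Collinear (pos u) (pos v) (pos w)

      no-three-concurrent : ∀ {e f g} → IsEdge e → IsEdge f → IsEdge g →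
        ¬ SameEdge e f → ¬ SameEdge f g → ¬ SameEdge e g →
        ¬ (∃[ p ] p InteriorToEdge e × p InteriorToEdge f × p InteriorToEdge g)

    Cross : V × V → V × V → Set (c ⊔ ℓ₁ ⊔ ℓ₂)
    Cross e f = IsEdge e × IsEdge f × ¬ SameEdge e f ×
      (∃[ p ] p InteriorToEdge e × p InteriorToEdge f)

  record GeoIso {V W} {G : SimpleGraph V} {H : SimpleGraph W}
                (Γ : GeometricGraph G) (Δ : GeometricGraph H)
                : Set (c ⊔ ℓ₁ ⊔ ℓ₂) where
    private
      module Γ = GeometricGraph Γ
      module Δ = GeometricGraph Δ
    field
      bijection : V ↔ W
    open Inverse bijection using (to)
    field
      adjacency : ∀ u v → Adj G u v ⇔ Adj H (to u) (to v)
      crossing  : ∀ u v w x →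
        Γ.Cross (u , v) (w , x) ⇔ Δ.Cross (to u , to v) (to w , to x)

  OnRay : Point → Point → Point → Set (c ⊔ ℓ₁ ⊔ ℓ₂)
  OnRay origin direction p = ∃[ t ] 0# <ᶠ t × p ≈ᵖ origin +ᵖ t ·ᵖ direction

  -- u and v point strictly to the same side of a line with direction w.
  SameSide : Point → Point → Point → Set ℓ₂
  SameSide w u v = 0# <ᶠ det w u * det w v

  -- For u and v on the same side of w: the angle between w and u is smaller
  -- than the angle between w and v, i.e. turning from u to v goes in the same
  -- direction as turning from w to v.
  SmallerAngle : Point → Point → Point → Set ℓ₂
  SmallerAngle w u v = 0# <ᶠ det w v * det u v

  record Realization {n} (π : Permutation′ n) : Set (c ⊔ ℓ₁ ⊔ ℓ₂) where
    field
      geometricGraph : GeometricGraph (K₂ n)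

    open GeometricGraph geometricGraph public

    A : Point
    A = pos a

    B : Point
    B = pos b

    field
      -- Directions of the rays from a and from b, each family listed in
      -- increasing order of angle with the segment ab.
      rayᵃ rayᵇ : Fin n → Point

      -- This already puts all 2n rays on one side of ab, as every ray from a
      -- is compared with every ray from b.
      same-side   : ∀ i j → SameSide (B -ᵖ A) (rayᵃ i) (rayᵇ j)
      increasingᵃ : ∀ {i j} → i < j → SmallerAngle (B -ᵖ A) (rayᵃ i) (rayᵃ j)
      increasingᵇ : ∀ {i j} → i < j → SmallerAngle (A -ᵖ B) (rayᵇ i) (rayᵇ j)
      meet        : ∀ i j → ∃[ p ] OnRay A (rayᵃ i) p × OnRay B (rayᵇ j) p

      -- The k-th ray from a is labelled π(k), the k-th ray from b is labelled k.
      placedᵃ : ∀ k → OnRay A (rayᵃ k) (pos (pt (π ⟨$⟩ʳ k)))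
      placedᵇ : ∀ k → OnRay B (rayᵇ k) (pos (pt k))

  -- Different realizations of the same permutation are geo-isomorphic, so
  -- "the" realization may be taken to be any of them.
  _∼_ : ∀ {n} → Permutation′ n → Permutation′ n → Set (c ⊔ ℓ₁ ⊔ ℓ₂)
  σ ∼ π = ∃₂ λ (R : Realization σ) (S : Realization π) →
    GeoIso (Realization.geometricGraph R) (Realization.geometricGraph S)

  [_] : ∀ {n} → Permutation′ n → Pred (Permutation′ n) (c ⊔ ℓ₁ ⊔ ℓ₂)
  [ π ] σ = σ ∼ π

-- In any realization of π the segments a i and b j cross iff (j , i) ∈ E(π): this is read off from
-- the signs of determinants. For n ≥ 3 a geo-isomorphism preserves {a , b}, so σ ∼ π iff D(σ) is
-- isomorphic to D(π) or, when a and b are exchanged, to its reverse. Realizations exist because, up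
-- to a projective map, the points may be placed at (u , v) with u decreasing along the rays from a
-- and v decreasing so fast along the rays from b that no three of them are collinear.
--
-- When G has only trivial modules and its complement is connected, its transitive orientation is
-- unique up to reversal. Colour a pair of vertices by whether it is a non-edge, or an edge on which
-- two given orientations agree, or an edge on which they differ. There is no rainbow triangle, so by
-- Gallai's lemma some colour is disconnected. It is not the colour of non-edges; and the components
-- of an edge colour are modules, so that colour does not occur at all.
--
-- The two linear orders on the entries of π are the union of E(π), or of its reverse, with the
-- non-inversions. Applying uniqueness to the complement of G shows that the non-inversions are
-- determined up to reversal, which leaves π and ((π^c)^-1)^c with the digraph D(π), and their
-- inverses with the reverse of D(π). Applying it to G itself shows that no other class is represented.
module Submission where

open import Defs
open import Algebra.Bundles using (CommutativeRing; RawRing)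
import Algebra.Properties.AbelianGroup as AbelianGroupProperties
import Algebra.Properties.Ring as RingProperties
import Algebra.Properties.Semiring.Mult as Mult
import Algebra.Solver.Ring as RingSolver
open import Algebra.Solver.Ring.AlmostCommutativeRing
  using (fromCommutativeRing; _-Raw-AlmostCommutative⟶_; Induced-equivalence)
import Data.Bool.Properties as Bool
open import Data.Fin.Base as Fin using (Fin; zero; suc; _<_; opposite)
import Data.Fin.Induction as Fin
open import Data.Fin.Patterns using (0F; 1F; 2F; 3F; 4F; 5F)
open import Data.Fin.Permutation as Perm
  using (Permutation′; permutation; flip; _⟨$⟩ʳ_; _⟨$⟩ˡ_; inverseˡ; inverseʳ; _∘ₚ_; reverse)
  renaming (_≈_ to _≈ₚ_)
import Data.Fin.Properties as Fin
open import Data.Fin.Subset as Subset using (Subset)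
open import Data.Fin.Subset.Properties using (∈⊤; x∈⁅y⁆⇒x≡y; anySubset?; nonempty?; _∈?_)
open import Data.Maybe.Base using (just; nothing)
open import Data.Nat.Base as ℕ using (ℕ; 2+; z≤n; s≤s)
import Data.Nat.Properties as ℕ
open import Data.Product.Base using (_×_; _,_; ∃; ∃₂; proj₁; proj₂; ∃-syntax)
import Data.Product.Properties as Product
open import Data.Sum.Base as Sum using (_⊎_; inj₁; inj₂; [_,_]′)
open import Data.Vec.Base using (Vec; []; _∷_; lookup; tabulate)
import Data.Vec.Properties as Vec
open import Function.Base using (_∘_; id)
open import Function.Bundles using (_⇔_; _↔_; mk⇔; mk↔ₛ′; module Equivalence; module Inverse)
open import Level using (Level; 0ℓ; _⊔_)
open import Relation.Binary.Construct.Closure.ReflexiveTransitive as Star using (Star; ε; _◅_; _◅◅_)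
open import Relation.Binary.Core using (Rel)
open import Relation.Binary.Definitions using (Decidable; Symmetric; WeaklyDecidable; tri<; tri≈; tri>)
open import Relation.Binary.PropositionalEquality as ≡ using (_≡_; _≢_)
import Relation.Binary.Reasoning.Setoid as SetoidReasoning
open import Relation.Binary.Structures using (IsStrictTotalOrder)
open import Relation.Nullary using (¬_; Dec; does; yes; no; ¬?; _×-dec_; _⊎-dec_; _→-dec_)
open import Relation.Nullary.Decidable using (True; dec-true; decidable-stable; from-no; from-yes; map′; toWitness)
open import Relation.Nullary.Negation using (contradiction)
open import Relation.Unary using (Pred; _∈_; _≐_)

open Equivalence using (to; from)

-- Connectivity in finite graphs

private
  -- One-vertex elimination: paths between the remaining vertices may shortcut through the vertex 0.
  Shortcut : ∀ {n} → Rel (Fin (ℕ.suc n)) 0ℓ → Rel (Fin n) 0ℓ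
  Shortcut R x y = R (suc x) (suc y) ⊎ (R (suc x) zero × R zero (suc y))

  module _ {n} {R : Rel (Fin (ℕ.suc n)) 0ℓ} where

    expand : ∀ {x y} → Star (Shortcut R) x y → Star R (suc x) (suc y)
    expand ε                  = ε
    expand (inj₁ r ◅ p)       = r ◅ expand p
    expand (inj₂ (r , s) ◅ p) = r ◅ s ◅ expand p

    -- A path from `zero` is recorded by the first arc that leaves `zero`; later visits to `zero`
    -- are absorbed into shortcuts.
    ToSuc : Fin (ℕ.suc n) → Fin n → Set
    ToSuc zero    y = ∃ λ x → R zero (suc x) × Star (Shortcut R) x y
    ToSuc (suc x) y = Star (Shortcut R) x y

    -- The end point is tied to `suc y` by an equation, so that the path can be matched on with a
    -- variable index. When a step enters `zero`, the recursive call supplies the arc leaving it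
    -- again, and the two arcs form a shortcut.
    shrink : ∀ {x y z} → Star R x z → z ≡ suc y → ToSuc x y
    shrink ε ≡.refl = ε
    shrink {zero}  (_◅_ {j = zero}  r p) eq = shrink p eq
    shrink {zero}  (_◅_ {j = suc x} r p) eq = x , r , shrink p eq
    shrink {suc x} (_◅_ {j = zero}  r p) eq with shrink p eq
    ... | x′ , r′ , p′ = inj₂ (r , r′) ◅ p′
    shrink {suc x} (_◅_ {j = suc x′} r p) eq = inj₁ r ◅ shrink p eq

    shrink₀ : ∀ {x z} → Star R (suc x) z → z ≡ zero → ∃ λ y → Star (Shortcut R) x y × R (suc y) zero
    shrink₀ (_◅_ {j = zero}  r p) eq = _ , ε , r
    shrink₀ (_◅_ {j = suc x} r p) eq with shrink₀ p eq
    ... | y , p′ , r′ = y , inj₁ r ◅ p′ , r′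

-- Induction on the number of vertices: eliminating vertex 0 leaves a decidable relation on one
-- vertex fewer, and a path that starts or ends at 0 splits off its first or last arc.
star? : ∀ {n} {R : Rel (Fin n) 0ℓ} → Decidable R → Decidable (Star R)
star? {ℕ.suc n} {R} R? = go
  where
  shortcut? : Decidable (Shortcut R)
  shortcut? x y = R? (suc x) (suc y) ⊎-dec (R? (suc x) zero ×-dec R? zero (suc y))

  rec : Decidable (Star (Shortcut R))
  rec = star? shortcut?

  go : Decidable (Star R)
  go zero    zero    = yes ε
  go zero    (suc y) = map′ (λ (_ , r , p) → r ◅ expand p) (λ p → shrink p ≡.refl)
                            (Fin.any? λ x → R? zero (suc x) ×-dec rec x y)
  go (suc x) zero    = map′ (λ (_ , p , r) → expand p ◅◅ r ◅ ε) (λ p → shrink₀ p ≡.refl)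
                            (Fin.any? λ y → rec x y ×-dec R? (suc y) zero)
  go (suc x) (suc y) = map′ expand (λ p → shrink p ≡.refl) (rec x y)

-- Gallai colourings

Colouring : ℕ → Set
Colouring n = Fin n → Fin n → Fin 3

-- In a symmetric colouring a triple with a repeated vertex satisfies this automatically, so only
-- genuine triangles are constrained.
RainbowFree : ∀ {n} → Colouring n → Set
RainbowFree col = ∀ x y z → col x y ≡ col y z ⊎ col x y ≡ col x z ⊎ col x z ≡ col y z

Joined : ∀ {n} → Colouring n → Fin 3 → Rel (Fin n) 0ℓ
Joined col X = Star (λ x y → col x y ≡ X)

joined? : ∀ {n} (col : Colouring n) X → Decidable (Joined col X)
joined? col X = star? (λ x y → col x y Fin.≟ X)

third-colour : ∀ {X Y : Fin 3} → X ≢ Y → ∃ λ Z → Z ≢ X × Z ≢ Y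
third-colour {0F} {0F} X≢Y = contradiction ≡.refl X≢Y
third-colour {0F} {1F} X≢Y = 2F , (λ ()) , λ ()
third-colour {0F} {2F} X≢Y = 1F , (λ ()) , λ ()
third-colour {1F} {0F} X≢Y = 2F , (λ ()) , λ ()
third-colour {1F} {1F} X≢Y = contradiction ≡.refl X≢Y
third-colour {1F} {2F} X≢Y = 0F , (λ ()) , λ ()
third-colour {2F} {0F} X≢Y = 1F , (λ ()) , λ ()
third-colour {2F} {1F} X≢Y = 0F , (λ ()) , λ ()
third-colour {2F} {2F} X≢Y = contradiction ≡.refl X≢Y

other-colour : ∀ (X : Fin 3) → ∃ λ Y → Y ≢ X
other-colour 0F = 1F , λ ()
other-colour 1F = 0F , λ ()
other-colour 2F = 0F , λ ()

module _ {n} {col : Colouring n} (col-sym : ∀ x y → col x y ≡ col y x) where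

  joined-sym : ∀ {X} → Symmetric (Joined col X)
  joined-sym = Star.reverse (λ {x} {y} eq → ≡.trans (col-sym y x) eq)

  -- For a single edge `s s′` of colour `X`, neither `w s` nor `w s′` has colour `X`, as `w` lies
  -- outside the component; the triangle is not rainbow, so these two colours agree. This propagates
  -- along the path.
  component-homogeneous : RainbowFree col → ∀ {X w s t} → ¬ Joined col X w s →
                          Joined col X s t → col w s ≡ col w t
  component-homogeneous rf w≁s ε = ≡.refl
  component-homogeneous rf {X} {w} {s} w≁s (_◅_ {j = s′} ss′ s′⇝t) =
    ≡.trans one-step (component-homogeneous rf w≁s′ s′⇝t)
    where
    w≁s′ : ¬ Joined col X w s′
    w≁s′ p = w≁s (p ◅◅ ≡.trans (col-sym s′ s) ss′ ◅ ε)

    one-step : col w s ≡ col w s′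
    one-step with rf w s s′
    ... | inj₁ e        = contradiction (≡.trans e ss′ ◅ ε) w≁s
    ... | inj₂ (inj₁ e) = e
    ... | inj₂ (inj₂ e) = contradiction (≡.trans e ss′ ◅ ε) w≁s′

isolated : ∀ {n} {col : Colouring (ℕ.suc n)} {X} → (∀ x → col zero (suc x) ≢ X) →
           ∀ {y z} → Joined col X y z → y ≡ zero → z ≡ zero
isolated none ε y≡0 = y≡0
isolated none (_◅_ {j = zero}  e p) ≡.refl = isolated none p ≡.refl
isolated none (_◅_ {j = suc x} e p) ≡.refl = contradiction e (none x)

module _ {n} (col : Colouring (2+ n)) (col-sym : ∀ x y → col x y ≡ col y x) (rf : RainbowFree col) where

  private
    col′ : Colouring (ℕ.suc n)
    col′ x y = col (suc x) (suc y)

    col′-sym : ∀ x y → col′ x y ≡ col′ y x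
    col′-sym x y = col-sym (suc x) (suc y)

    rf′ : RainbowFree col′
    rf′ x y z = rf (suc x) (suc y) (suc z)

    reached? : ∀ X t → Dec (∃[ s ] Joined col′ X t s × col zero (suc s) ≡ X)
    reached? X t = Fin.any? λ s → joined? col′ X t s ×-dec (col zero (suc s) Fin.≟ X)

  disconnected-at-0 : ∀ {X} → (∀ x → col zero (suc x) ≢ X) → ∃ λ X → ∃₂ λ u v → ¬ Joined col X u v
  disconnected-at-0 {X} none = X , 0F , 1F , λ p → contradiction (isolated none p ≡.refl) λ ()

  -- The induction step of Gallai's lemma, putting vertex 0 back. If some component of colour `X`
  -- has no edge of that colour to 0, then `X` stays disconnected. Otherwise some colour does not
  -- occur at 0 and therefore isolates it.
  extend-disconnected : ∀ {X u v} → ¬ Joined col′ X u v → ∃ λ X → ∃₂ λ u v → ¬ Joined col X u v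
  extend-disconnected {X} {u} {v} u≁v
    with Fin.all? (reached? X)
  -- No edge of colour `X` leads from the component of `t` to 0, so a path of that colour starting
  -- at `t` never leaves the component.
  ... | no ¬reached with Fin.¬∀⟶∃¬ _ _ (reached? X) ¬reached
  ...   | t , t≁0 = X , suc t , zero , λ p → stays p ε ≡.refl
    where
    stays : ∀ {s z} → Joined col X (suc s) z → Joined col′ X t s → z ≢ zero
    stays ε t⇝s ()
    stays (_◅_ {j = zero}  e p) t⇝s = contradiction (_ , t⇝s , ≡.trans (col-sym _ _) e) t≁0
    stays (_◅_ {j = suc _} e p) t⇝s = stays p (t⇝s ◅◅ e ◅ ε)
  extend-disconnected {X} {u} {v} u≁v | yes reached
    with Fin.any? (λ w → ¬? (col zero (suc w) Fin.≟ X))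
  ... | no  all-X = disconnected-at-0 {proj₁ (other-colour X)}
                      λ x e → all-X (x , λ e′ → proj₂ (other-colour X) (≡.trans (≡.sym e) e′))
  ... | yes (w , w≢X) with third-colour w≢X
  ...   | Z , Z≢Y , Z≢X = disconnected-at-0 {Z} no-Z
    where
    -- The component of `t` contains some `s` joined to 0 in colour `X`, and `w` sees the whole
    -- component in one colour. In the triangle of `w`, 0 and `s`, only the edge from 0 to `s` has
    -- colour `X`, so the other two agree.
    outside : ∀ {w t} → col zero (suc w) ≢ X → ¬ Joined col′ X w t → col′ w t ≡ col zero (suc w)
    outside {w} {t} w≢X w≁t with reached t
    ... | s , t⇝s , 0s = ≡.trans (component-homogeneous col′-sym rf′ w≁t t⇝s) ws
      where
      ws : col′ w s ≡ col zero (suc w)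
      ws with rf (suc w) zero (suc s)
      ... | inj₁ e        = contradiction (≡.trans (≡.trans (col-sym _ _) e) 0s) w≢X
      ... | inj₂ (inj₁ e) = ≡.trans (≡.sym e) (col-sym _ _)
      ... | inj₂ (inj₂ e) = contradiction (joined-sym col′-sym (t⇝s ◅◅ ≡.trans (col′-sym _ _) (≡.trans e 0s) ◅ ε)) w≁t

    elsewhere : ∃ λ t → ¬ Joined col′ X w t
    elsewhere with joined? col′ X w u
    ... | yes w⇝u = v , λ w⇝v → u≁v (joined-sym col′-sym w⇝u ◅◅ w⇝v)
    ... | no  w≁u = u , w≁u

    -- If `w` and `z` lie in different components, `outside` from either end equates the colours of
    -- their edges to 0. If they lie in the same one, a vertex `t` of another component sees both in
    -- the same colour, and `outside` is applied to `t`.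
    no-Z : ∀ z → col zero (suc z) ≢ Z
    no-Z z 0z with joined? col′ X w z
    ... | no w≁z = Z≢Y (≡.trans (≡.sym 0z) (≡.trans (≡.sym (outside z≢X (w≁z ∘ joined-sym col′-sym)))
                                       (≡.trans (col′-sym z w) (outside w≢X w≁z))))
      where
      z≢X : col zero (suc z) ≢ X
      z≢X e = Z≢X (≡.trans (≡.sym 0z) e)
    ... | yes w⇝z with elsewhere
    ...   | t , w≁t = Z≢Y (≡.trans (≡.sym 0z) (≡.trans (≡.sym (outside z≢X z≁t)) (≡.trans (col′-sym z t)
                        (≡.trans (≡.sym (component-homogeneous col′-sym rf′ (w≁t ∘ joined-sym col′-sym) w⇝z))
                        (≡.trans (col′-sym t w) (outside w≢X w≁t))))))
      where
      z≢X : col zero (suc z) ≢ X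
      z≢X e = Z≢X (≡.trans (≡.sym 0z) e)
      z≁t : ¬ Joined col′ X z t
      z≁t z⇝t = w≁t (w⇝z ◅◅ z⇝t)

gallai : ∀ {n} (col : Colouring (2+ n)) → (∀ x y → col x y ≡ col y x) → RainbowFree col →
         ∃ λ X → ∃₂ λ u v → ¬ Joined col X u v
gallai {ℕ.zero}  col col-sym rf with other-colour (col 0F 1F)
... | X , X≢ = disconnected-at-0 col col-sym rf {X} λ { zero e → X≢ (≡.sym e) }
gallai {ℕ.suc n} col col-sym rf
  with gallai (λ x y → col (suc x) (suc y)) (λ x y → col-sym (suc x) (suc y)) (λ x y z → rf (suc x) (suc y) (suc z))
... | X , u , v , u≁v = extend-disconnected col col-sym rf u≁v

-- Transitive orientations

module _ {n} {P : Pred (Fin n) 0ℓ} (P? : ∀ x → Dec (P x)) where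

  comprehension : Subset n
  comprehension = tabulate (does ∘ P?)

  ∈-comprehension⁺ : ∀ {x} → P x → x Subset.∈ comprehension
  ∈-comprehension⁺ {x} px = Vec.lookup⇒[]= x _ (≡.trans (Vec.lookup∘tabulate _ x) (dec-true (P? x) px))

  ∈-comprehension⁻ : ∀ {x} → x Subset.∈ comprehension → P x
  ∈-comprehension⁻ {x} x∈ with P? x in eq
  ... | yes px = px
  ... | no  _  = contradiction (≡.trans (≡.sym (Vec.[]=⇒lookup x∈))
                                  (≡.trans (Vec.lookup∘tabulate _ x) (≡.cong does eq))) λ ()

module _ {n} {G : SimpleGraph (Fin n)} {F : Digraph n} (F-to : IsTransitiveOrientation G F) where
  open IsTransitiveOrientation F-to renaming (trans to F-trans)

  arc-asym : ∀ {u v} → F u v → ¬ F v u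
  arc-asym uv vu with edge⇒arc! (arc⇒edge uv)
  ... | inj₁ (_ , ¬vu) = ¬vu vu
  ... | inj₂ (¬uv , _) = ¬uv uv

  orient : ∀ {u v} → Adj G u v → F u v ⊎ F v u
  orient e = Sum.map proj₁ proj₂ (edge⇒arc! e)

  pullback : ∀ {m} {H : SimpleGraph (Fin m)} (f : Fin m → Fin n) →
             (∀ {u v} → Adj H u v → Adj G (f u) (f v)) → (∀ {u v} → Adj G (f u) (f v) → Adj H u v) →
             IsTransitiveOrientation H (λ u v → F (f u) (f v))
  pullback f preserves reflects = record
    { arc⇒edge  = reflects ∘ arc⇒edge
    ; edge⇒arc! = edge⇒arc! ∘ preserves
    ; trans     = F-trans
    }

-- Edges on which two transitive orientations agree, edges on which they disagree, and non-edges
-- form a 3-colouring without rainbow triangles.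
module Comparison {n} {G : SimpleGraph (Fin n)} (adj? : Decidable (Adj G)) {P Q : Digraph n}
                  (P-to : IsTransitiveOrientation G P) (Q-to : IsTransitiveOrientation G Q) where
  private
    module P = IsTransitiveOrientation P-to
    module Q = IsTransitiveOrientation Q-to

  -- The colour forgets in which direction the edge points; the constructors keep it, and the
  -- arguments about triangles need it.
  data View (u v : Fin n) : Fin 3 → Set where
    nonedge        : ¬ Adj G u v → View u v 0F
    agree          : P u v → Q u v → View u v 1F
    agree-rev      : P v u → Q v u → View u v 1F
    differ         : P u v → Q v u → View u v 2F
    differ-rev     : P v u → Q u v → View u v 2F

  view : ∀ u v → ∃ (View u v)
  view u v with adj? u v
  ... | no  ¬e = 0F , nonedge ¬e
  ... | yes e with orient P-to e | orient Q-to e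
  ...   | inj₁ p | inj₁ q = 1F , agree p q
  ...   | inj₁ p | inj₂ q = 2F , differ p q
  ...   | inj₂ p | inj₁ q = 2F , differ-rev p q
  ...   | inj₂ p | inj₂ q = 1F , agree-rev p q

  view-sym : ∀ {u v X} → View u v X → View v u X
  view-sym (nonedge ¬e)     = nonedge (¬e ∘ SimpleGraph.symm G)
  view-sym (agree p q)      = agree-rev p q
  view-sym (agree-rev p q)  = agree p q
  view-sym (differ p q)     = differ-rev p q
  view-sym (differ-rev p q) = differ p q

  edge≢0 : ∀ {u v} → Adj G u v → ¬ View u v 0F
  edge≢0 e (nonedge ¬e) = ¬e e

  1≢2 : ∀ {u v} → View u v 1F → ¬ View u v 2F
  1≢2 (agree p q)     (differ p′ q′)     = arc-asym Q-to q q′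
  1≢2 (agree p q)     (differ-rev p′ q′) = arc-asym P-to p p′
  1≢2 (agree-rev p q) (differ p′ q′)     = arc-asym P-to p p′
  1≢2 (agree-rev p q) (differ-rev p′ q′) = arc-asym Q-to q q′

  view-edge : ∀ {u v X} → View u v X → X ≢ 0F → Adj G u v
  view-edge (nonedge _)      X≢0 = contradiction ≡.refl X≢0
  view-edge (agree p _)      _   = P.arc⇒edge p
  view-edge (agree-rev p _)  _   = SimpleGraph.symm G (P.arc⇒edge p)
  view-edge (differ p _)     _   = P.arc⇒edge p
  view-edge (differ-rev p _) _   = SimpleGraph.symm G (P.arc⇒edge p)

  view-unique : ∀ {u v X Y} → View u v X → View u v Y → X ≡ Y
  view-unique {X = 0F} {0F} x y = ≡.refl
  view-unique {X = 0F} {1F} x y = contradiction x (edge≢0 (view-edge y λ ()))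
  view-unique {X = 0F} {2F} x y = contradiction x (edge≢0 (view-edge y λ ()))
  view-unique {X = 1F} {0F} x y = contradiction y (edge≢0 (view-edge x λ ()))
  view-unique {X = 1F} {1F} x y = ≡.refl
  view-unique {X = 1F} {2F} x y = contradiction y (1≢2 x)
  view-unique {X = 2F} {0F} x y = contradiction y (edge≢0 (view-edge x λ ()))
  view-unique {X = 2F} {1F} x y = contradiction x (1≢2 y)
  view-unique {X = 2F} {2F} x y = ≡.refl

  col : Colouring n
  col u v = proj₁ (view u v)

  col-sym : ∀ u v → col u v ≡ col v u
  col-sym u v = view-unique (proj₂ (view u v)) (view-sym (proj₂ (view v u)))

  -- Agreement on one edge and disagreement on the next mean that in exactly one of the two
  -- orientations the arcs form a directed path through `y`. Transitivity of that orientation gives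
  -- an edge between `x` and `z`.
  no-rainbow : ∀ {x y z} → View x y 1F → View y z 2F → ¬ View x z 0F
  no-rainbow (agree p q)     (differ p′ q′)     = edge≢0 (P.arc⇒edge (P.trans p p′))
  no-rainbow (agree p q)     (differ-rev p′ q′) = edge≢0 (Q.arc⇒edge (Q.trans q q′))
  no-rainbow (agree-rev p q) (differ p′ q′)     = edge≢0 (SimpleGraph.symm G (Q.arc⇒edge (Q.trans q′ q)))
  no-rainbow (agree-rev p q) (differ-rev p′ q′) = edge≢0 (SimpleGraph.symm G (P.arc⇒edge (P.trans p′ p)))

  rainbowFree : RainbowFree col
  rainbowFree x y z = go (proj₂ (view x y)) (proj₂ (view y z)) (proj₂ (view x z))
    where
    go : ∀ {X Y Z} → View x y X → View y z Y → View x z Z → X ≡ Y ⊎ X ≡ Z ⊎ Z ≡ Y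
    go {X} {Y} {Z} u v w with X Fin.≟ Y | X Fin.≟ Z | Z Fin.≟ Y
    ... | yes e | _     | _     = inj₁ e
    ... | no _  | yes e | _     = inj₂ (inj₁ e)
    ... | no _  | no _  | yes e = inj₂ (inj₂ e)
    go {0F} {0F} {_}  u v w | no ≢ | _    | _    = contradiction ≡.refl ≢
    go {1F} {1F} {_}  u v w | no ≢ | _    | _    = contradiction ≡.refl ≢
    go {2F} {2F} {_}  u v w | no ≢ | _    | _    = contradiction ≡.refl ≢
    go {0F} {_}  {0F} u v w | no _ | no ≢ | _    = contradiction ≡.refl ≢
    go {1F} {_}  {1F} u v w | no _ | no ≢ | _    = contradiction ≡.refl ≢
    go {2F} {_}  {2F} u v w | no _ | no ≢ | _    = contradiction ≡.refl ≢
    go {_}  {0F} {0F} u v w | no _ | no _ | no ≢ = contradiction ≡.refl ≢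
    go {_}  {1F} {1F} u v w | no _ | no _ | no ≢ = contradiction ≡.refl ≢
    go {_}  {2F} {2F} u v w | no _ | no _ | no ≢ = contradiction ≡.refl ≢
    -- Six arrangements of three distinct colours remain. The edges of colours 1 and 2 share a
    -- vertex, which takes the role of `y` in `no-rainbow`.
    go {0F} {1F} {2F} u v w | no _ | no _ | no _ = contradiction (view-sym u) (no-rainbow v (view-sym w))
    go {0F} {2F} {1F} u v w | no _ | no _ | no _ = contradiction u (no-rainbow w (view-sym v))
    go {1F} {0F} {2F} u v w | no _ | no _ | no _ = contradiction v (no-rainbow (view-sym u) w)
    go {1F} {2F} {0F} u v w | no _ | no _ | no _ = contradiction w (no-rainbow u v)
    go {2F} {0F} {1F} u v w | no _ | no _ | no _ = contradiction (view-sym v) (no-rainbow (view-sym w) u)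
    go {2F} {1F} {0F} u v w | no _ | no _ | no _ = contradiction (view-sym w) (no-rainbow (view-sym v) (view-sym u))

  module _ (trivial-modules : OnlyTrivialModules G) where

    -- A component of an edge colour is a module, hence everything or a single vertex.
    colour-connected : ∀ {X} → X ≢ 0F → ∀ {u v} → View u v X → ∀ s t → Joined col X s t
    colour-connected {X} X≢0 {u} {v} uv s t = conclude (trivial-modules M ((u , ∈M⁺ ε) , homogeneous))
      where
      M : Subset n
      M = comprehension (joined? col X u)

      ∈M⁺ : ∀ {w} → Joined col X u w → w Subset.∈ M
      ∈M⁺ = ∈-comprehension⁺ (joined? col X u)

      ∈M⁻ : ∀ {w} → w Subset.∈ M → Joined col X u w
      ∈M⁻ = ∈-comprehension⁻ (joined? col X u)

      homogeneous : ∀ w → w Subset.∉ M →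
                    (∀ m → m Subset.∈ M → Adj G w m) ⊎ (∀ m → m Subset.∈ M → ¬ Adj G w m)
      homogeneous w w∉M with col w u in eq
      -- From `w` all of the component is seen in the colour of the pair `w`, `u`, and the colour
      -- tells whether there is an edge.
      ... | Y = decide Y λ m m∈M → ≡.subst (View w m)
                  (≡.trans (≡.sym (component-homogeneous col-sym rainbowFree
                                (w∉M ∘ ∈M⁺ ∘ joined-sym col-sym) (∈M⁻ m∈M))) eq)
                  (proj₂ (view w m))
        where
        decide : ∀ Y → (∀ m → m Subset.∈ M → View w m Y) →
                 (∀ m → m Subset.∈ M → Adj G w m) ⊎ (∀ m → m Subset.∈ M → ¬ Adj G w m)
        decide 0F same = inj₂ λ m m∈M e → edge≢0 e (same m m∈M)
        decide 1F same = inj₁ λ m m∈M → view-edge (same m m∈M) λ ()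
        decide 2F same = inj₁ λ m m∈M → view-edge (same m m∈M) λ ()

      conclude : M ≡ Subset.⊤ ⊎ (∃[ w ] M ≡ Subset.⁅ w ⁆) → Joined col X s t
      conclude (inj₁ M≡⊤) = joined-sym col-sym (all s) ◅◅ all t
        where
        all : ∀ w → Joined col X u w
        all w = ∈M⁻ (≡.subst (w Subset.∈_) (≡.sym M≡⊤) ∈⊤)
      -- The component contains both ends of the edge from `u` to `v`, so it is not a singleton.
      conclude (inj₂ (w , M≡⁅w⁆)) =
        contradiction (view-edge uv X≢0) (SimpleGraph.irrefl G (≡.trans (only ε) (≡.sym (only u⇝v))))
        where
        u⇝v : Joined col X u v
        u⇝v = view-unique (proj₂ (view u v)) uv ◅ ε
        only : ∀ {x} → Joined col X u x → x ≡ w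
        only p = x∈⁅y⁆⇒x≡y w (≡.subst (_ Subset.∈_) M≡⁅w⁆ (∈M⁺ p))

    -- The paths of the complement exclude colour 0 as the disconnected colour supplied by `gallai`.
    -- A disconnected edge colour is empty by `colour-connected`: without agreements `Q` is the
    -- reverse of `P`, without disagreements it is `P`.
    unique-orientation : 1 ℕ.< n → Connected (complement G) →
                         (∀ {u v} → P u v ⇔ Q u v) ⊎ (∀ {u v} → P u v ⇔ Q v u)
    unique-orientation (s≤s (s≤s z≤n)) co-connected with gallai col col-sym rainbowFree
    ... | 0F , s , t , s≁t = contradiction
      (Star.map (λ {x} {y} (_ , ¬e) → view-unique (proj₂ (view x y)) (nonedge ¬e)) (co-connected s t)) s≁t
    ... | 1F , s , t , s≁t = inj₂ (mk⇔ P⇒Q Q⇒P)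
      where
      none : ∀ {u v} → ¬ View u v 1F
      none uv = s≁t (colour-connected (λ ()) uv s t)
      P⇒Q : ∀ {u v} → P u v → Q v u
      P⇒Q p with orient Q-to (P.arc⇒edge p)
      ... | inj₁ q = contradiction (agree p q) none
      ... | inj₂ q = q
      Q⇒P : ∀ {u v} → Q v u → P u v
      Q⇒P q with orient P-to (Q.arc⇒edge q)
      ... | inj₁ p = contradiction (agree p q) none
      ... | inj₂ p = p
    ... | 2F , s , t , s≁t = inj₁ (mk⇔ P⇒Q Q⇒P)
      where
      none : ∀ {u v} → ¬ View u v 2F
      none uv = s≁t (colour-connected (λ ()) uv s t)
      P⇒Q : ∀ {u v} → P u v → Q u v
      P⇒Q p with orient Q-to (P.arc⇒edge p)
      ... | inj₁ q = q
      ... | inj₂ q = contradiction (differ p q) none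
      Q⇒P : ∀ {u v} → Q u v → P u v
      Q⇒P q with orient P-to (Q.arc⇒edge q)
      ... | inj₁ p = p
      ... | inj₂ p = contradiction (differ-rev p q) none

-- Permutations as pairs of linear orders

-- Sends `i` to `opposite (π ⟨$⟩ˡ opposite i)`: the reflection of the permutation matrix in its
-- antidiagonal, as `flip` is the reflection in the diagonal.
_ʳ : ∀ {n} → Permutation′ n → Permutation′ n
π ʳ = (flip (π ᶜ)) ᶜ

infix 30 _ʳ

_≈ₚ?_ : ∀ {n} (σ π : Permutation′ n) → Dec (σ ≈ₚ π)
σ ≈ₚ? π = Fin.all? λ i → (σ ⟨$⟩ʳ i) Fin.≟ (π ⟨$⟩ʳ i)

≈⇒≈ˡ : ∀ {n} (σ π : Permutation′ n) → σ ≈ₚ π → flip σ ≈ₚ flip π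
≈⇒≈ˡ σ π σ≈π i = begin
  σ ⟨$⟩ˡ i                      ≡⟨ ≡.cong (σ ⟨$⟩ˡ_) (inverseʳ π) ⟨
  σ ⟨$⟩ˡ (π ⟨$⟩ʳ (π ⟨$⟩ˡ i))  ≡⟨ ≡.cong (σ ⟨$⟩ˡ_) (σ≈π _) ⟨
  σ ⟨$⟩ˡ (σ ⟨$⟩ʳ (π ⟨$⟩ˡ i))  ≡⟨ inverseˡ σ ⟩
  π ⟨$⟩ˡ i                      ∎
  where open ≡.≡-Reasoning

injectiveʳ : ∀ {n} (π : Permutation′ n) {i j} → π ⟨$⟩ʳ i ≡ π ⟨$⟩ʳ j → i ≡ j
injectiveʳ π e = ≡.trans (≡.sym (inverseˡ π)) (≡.trans (≡.cong (π ⟨$⟩ˡ_) e) (inverseˡ π))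

injectiveˡ : ∀ {n} (π : Permutation′ n) {i j} → π ⟨$⟩ˡ i ≡ π ⟨$⟩ˡ j → i ≡ j
injectiveˡ π = injectiveʳ (flip π)

opposite-anti : ∀ {n} {i j : Fin n} → i < j → opposite j < opposite i
opposite-anti {n} {i} {j} i<j =
  ≡.subst₂ ℕ._<_ (≡.sym (Fin.opposite-prop j)) (≡.sym (Fin.opposite-prop i)) (ℕ.∸-monoʳ-< (s≤s i<j) (Fin.toℕ<n j))

opposite-anti⁻ : ∀ {n} {i j : Fin n} → opposite j < opposite i → i < j
opposite-anti⁻ p = ≡.subst₂ _<_ (Fin.opposite-involutive _) (Fin.opposite-involutive _) (opposite-anti p)

Monotone : ∀ {n} → (Fin n → Fin n) → Set
Monotone f = ∀ {i j} → i < j → f i < f j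

monotone⇒increasing : ∀ {n} {f : Fin n → Fin n} → Monotone f → ∀ i → i Fin.≤ f i
monotone⇒increasing {ℕ.suc n} {f} mono = Fin.<-weakInduction (λ i → i Fin.≤ f i) z≤n λ i i≤fi →
  ℕ.<-≤-trans (s≤s (≡.subst (ℕ._≤ Fin.toℕ (f (Fin.inject₁ i))) (Fin.toℕ-inject₁ i) i≤fi))
              (mono {Fin.inject₁ i} {suc i} (s≤s (ℕ.≤-reflexive (Fin.toℕ-inject₁ i))))

-- A strictly monotone self-map lies above the identity. The inverse is monotone as well, and its
-- bound at `f ⟨$⟩ʳ i` is the opposite inequality.
monotone⇒id : ∀ {n} (f : Permutation′ n) → Monotone (f ⟨$⟩ʳ_) → f ≈ₚ Perm.id
monotone⇒id f mono i = Fin.≤-antisym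
  (≡.subst ((f ⟨$⟩ʳ i) Fin.≤_) (inverseˡ f) (monotone⇒increasing mono⁻¹ (f ⟨$⟩ʳ i)))
  (monotone⇒increasing mono i)
  where
  mono⁻¹ : Monotone (f ⟨$⟩ˡ_)
  mono⁻¹ {i} {j} i<j with Fin.<-cmp (f ⟨$⟩ˡ i) (f ⟨$⟩ˡ j)
  ... | tri< lt _ _ = lt
  ... | tri≈ _ eq _ = contradiction (injectiveˡ f eq) (Fin.<⇒≢ i<j)
  ... | tri> _ _ gt = contradiction (≡.subst₂ _<_ (inverseʳ f) (inverseʳ f) (mono gt)) (Fin.<-asym i<j)

-- Inversions and non-inversions together determine both linear orders.
N : ∀ {n} → Permutation′ n → Digraph n
N π i j = i < j × (π ⟨$⟩ˡ i) < (π ⟨$⟩ˡ j)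

module _ {n} (π : Permutation′ n) where

  compareʳ : ∀ {u v} → u < v → E π u v ⊎ N π u v
  compareʳ {u} {v} u<v with Fin.<-cmp (π ⟨$⟩ˡ u) (π ⟨$⟩ˡ v)
  ... | tri< lt _ _ = inj₂ (u<v , lt)
  ... | tri≈ _ eq _ = contradiction (injectiveˡ π eq) (Fin.<⇒≢ u<v)
  ... | tri> _ _ gt = inj₁ (u<v , gt)

  compareˡ : ∀ {u v} → (π ⟨$⟩ˡ u) < (π ⟨$⟩ˡ v) → E π v u ⊎ N π u v
  compareˡ {u} {v} lt with Fin.<-cmp u v
  ... | tri< u<v _ _ = inj₂ (u<v , lt)
  ... | tri≈ _ u≡v _ = contradiction (≡.cong (π ⟨$⟩ˡ_) u≡v) (Fin.<⇒≢ lt)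
  ... | tri> _ _ v<u = inj₁ (v<u , lt)

  adj? : Decidable (Adj G⟨ π ⟩)
  adj? u v = e? u v ⊎-dec e? v u
    where
    e? : Decidable (E π)
    e? u v = (u Fin.<? v) ×-dec ((π ⟨$⟩ˡ v) Fin.<? (π ⟨$⟩ˡ u))

  E-orientation : IsTransitiveOrientation G⟨ π ⟩ (E π)
  E-orientation = record
    { arc⇒edge  = inj₁
    ; edge⇒arc! = Sum.map (λ { e@(u<v , _) → e , λ (v<u , _) → Fin.<-asym u<v v<u })
                          (λ { e@(v<u , _) → (λ (u<v , _) → Fin.<-asym u<v v<u) , e })
    ; trans     = λ (u<v , p) (v<w , q) → Fin.<-trans u<v v<w , Fin.<-trans q p
    }

  N-orientation : IsTransitiveOrientation (complement G⟨ π ⟩) (N π)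
  N-orientation = record
    { arc⇒edge  = λ (u<v , p) → Fin.<⇒≢ u<v , λ { (inj₁ (_ , q)) → Fin.<-asym p q ; (inj₂ (v<u , _)) → Fin.<-asym u<v v<u }
    ; edge⇒arc! = edge⇒arc!
    ; trans     = λ (u<v , p) (v<w , q) → Fin.<-trans u<v v<w , Fin.<-trans p q
    }
    where
    edge⇒arc! : ∀ {u v} → Adj (complement G⟨ π ⟩) u v → (N π u v × ¬ N π v u) ⊎ (¬ N π u v × N π v u)
    edge⇒arc! {u} {v} (u≢v , ¬e) with Fin.<-cmp u v
    ... | tri≈ _ u≡v _ = contradiction u≡v u≢v
    ... | tri< u<v _ _ with compareʳ u<v
    ...   | inj₁ e = contradiction (inj₁ e) ¬e
    ...   | inj₂ m = inj₁ (m , λ (v<u , _) → Fin.<-asym u<v v<u)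
    edge⇒arc! {u} {v} (u≢v , ¬e) | tri> _ _ v<u with compareʳ v<u
    ...   | inj₁ e = contradiction (inj₂ e) ¬e
    ...   | inj₂ m = inj₂ ((λ (u<v , _) → Fin.<-asym u<v v<u) , m)

-- A pair `u < v` of values is an inversion or a non-inversion, so `f` is monotone and hence the
-- identity. Ordering by positions is likewise made up of reversed inversions and of non-inversions,
-- so `f` read on positions is monotone too.
order-rigid : ∀ {n} {σ π : Permutation′ n} (f : Permutation′ n) →
              (∀ {u v} → E σ u v → E π (f ⟨$⟩ʳ u) (f ⟨$⟩ʳ v)) →
              (∀ {u v} → N σ u v → N π (f ⟨$⟩ʳ u) (f ⟨$⟩ʳ v)) → σ ≈ₚ π
order-rigid {σ = σ} {π} f E⇒E N⇒N k = begin
  σ ⟨$⟩ʳ k                                 ≡⟨ f≈id _ ⟨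
  f ⟨$⟩ʳ (σ ⟨$⟩ʳ k)                        ≡⟨ inverseʳ π ⟨
  π ⟨$⟩ʳ (π ⟨$⟩ˡ (f ⟨$⟩ʳ (σ ⟨$⟩ʳ k)))  ≡⟨ ≡.cong (π ⟨$⟩ʳ_) (monotone⇒id (σ ∘ₚ f ∘ₚ flip π) mono k) ⟩
  π ⟨$⟩ʳ k                                 ∎
  where
  open ≡.≡-Reasoning
  f≈id : f ≈ₚ Perm.id
  f≈id = monotone⇒id f λ u<v → [ proj₁ ∘ E⇒E , proj₁ ∘ N⇒N ]′ (compareʳ σ u<v)

  mono : Monotone ((σ ∘ₚ f ∘ₚ flip π) ⟨$⟩ʳ_)
  mono i<j = [ proj₂ ∘ E⇒E , proj₂ ∘ N⇒N ]′
    (compareˡ σ (≡.subst₂ _<_ (≡.sym (inverseˡ σ)) (≡.sym (inverseˡ σ)) i<j))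

-- Isomorphisms of inversion digraphs

_ᵒ : ∀ {n} → Digraph n → Digraph n
(F ᵒ) u v = F v u

≅ᵈ-refl : ∀ {n} (F : Digraph n) → F ≅ᵈ F
≅ᵈ-refl F = Perm.id , λ _ _ → mk⇔ id id

≅ᵈ-sym : ∀ {n} (F H : Digraph n) → F ≅ᵈ H → H ≅ᵈ F
≅ᵈ-sym F H (f , F⇔H) = flip f , λ u v → mk⇔
  (λ h → from (F⇔H _ _) (≡.subst₂ H (≡.sym (inverseʳ f)) (≡.sym (inverseʳ f)) h))
  (λ h → ≡.subst₂ H (inverseʳ f) (inverseʳ f) (to (F⇔H _ _) h))

≅ᵈ-trans : ∀ {n} (F H K : Digraph n) → F ≅ᵈ H → H ≅ᵈ K → F ≅ᵈ K
≅ᵈ-trans F H K (f , F⇔H) (g , H⇔K) = f ∘ₚ g , λ u v → mk⇔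
  (to (H⇔K _ _) ∘ to (F⇔H u v)) (from (F⇔H u v) ∘ from (H⇔K _ _))

≅ᵈ-ᵒ : ∀ {n} (F H : Digraph n) → F ≅ᵈ H → (F ᵒ) ≅ᵈ (H ᵒ)
≅ᵈ-ᵒ F H (f , F⇔H) = f , λ u v → F⇔H v u

⇔⇒≅ᵈ : ∀ {n} {F H : Digraph n} → (∀ {u v} → F u v ⇔ H u v) → F ≅ᵈ H
⇔⇒≅ᵈ F⇔H = Perm.id , λ _ _ → F⇔H

-- The combinatorial counterpart of `∼`; the reversed digraph accounts for geo-isomorphisms that
-- exchange `a` and `b`.
_≅±_ : ∀ {n} → Permutation′ n → Permutation′ n → Set
σ ≅± π = D σ ≅ᵈ D π ⊎ D σ ≅ᵈ (D π ᵒ)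

≅±-refl : ∀ {n} (π : Permutation′ n) → π ≅± π
≅±-refl π = inj₁ (≅ᵈ-refl (D π))

≅±-sym : ∀ {n} (σ π : Permutation′ n) → σ ≅± π → π ≅± σ
≅±-sym σ π = Sum.map (≅ᵈ-sym (D σ) (D π)) (≅ᵈ-ᵒ (D π ᵒ) (D σ) ∘ ≅ᵈ-sym (D σ) (D π ᵒ))

≅±-trans : ∀ {n} (ρ σ π : Permutation′ n) → ρ ≅± σ → σ ≅± π → ρ ≅± π
≅±-trans ρ σ π (inj₁ i) (inj₁ j) = inj₁ (≅ᵈ-trans (D ρ) (D σ) (D π) i j)
≅±-trans ρ σ π (inj₁ i) (inj₂ j) = inj₂ (≅ᵈ-trans (D ρ) (D σ) (D π ᵒ) i j)
≅±-trans ρ σ π (inj₂ i) (inj₁ j) = inj₂ (≅ᵈ-trans (D ρ) (D σ ᵒ) (D π ᵒ) i (≅ᵈ-ᵒ (D σ) (D π) j))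
≅±-trans ρ σ π (inj₂ i) (inj₂ j) = inj₁ (≅ᵈ-trans (D ρ) (D σ ᵒ) (D π) i (≅ᵈ-ᵒ (D σ) (D π ᵒ) j))

≈⇒≅± : ∀ {n} (σ π : Permutation′ n) → σ ≈ₚ π → σ ≅± π
≈⇒≅± σ π σ≈π = inj₁ (⇔⇒≅ᵈ {F = D σ} {D π} λ {u} {v} → mk⇔
  (λ (u<v , p) → u<v , ≡.subst₂ _<_ (≈⇒≈ˡ σ π σ≈π v) (≈⇒≈ˡ σ π σ≈π u) p)
  (λ (u<v , p) → u<v , ≡.subst₂ _<_ (≡.sym (≈⇒≈ˡ σ π σ≈π v)) (≡.sym (≈⇒≈ˡ σ π σ≈π u)) p))

-- The map `π` from positions to values exchanges the two linear orders, and this reverses each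
-- inversion.
flip-≅ᵈ : ∀ {n} (π : Permutation′ n) → D (flip π) ≅ᵈ (D π ᵒ)
flip-≅ᵈ π = π , λ u v → mk⇔
  (λ (u<v , p) → p , ≡.subst₂ _<_ (≡.sym (inverseˡ π)) (≡.sym (inverseˡ π)) u<v)
  (λ (p , u<v) → ≡.subst₂ _<_ (inverseˡ π) (inverseˡ π) u<v , p)

-- Exchanges the two linear orders and reverses both. The exchange reverses inversions and keeps
-- non-inversions, while the double reversal reverses both kinds; together, inversions are kept and
-- non-inversions are reversed.
ʳ-iso : ∀ {n} → Permutation′ n → Permutation′ n
ʳ-iso π = flip π ∘ₚ reverse

ʳ-iso-ˡ : ∀ {n} (π : Permutation′ n) u → π ʳ ⟨$⟩ˡ (ʳ-iso π ⟨$⟩ʳ u) ≡ opposite u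
ʳ-iso-ˡ π u = ≡.cong opposite (≡.trans (≡.cong (π ⟨$⟩ʳ_) (Fin.opposite-involutive _)) (inverseʳ π))

ʳ-iso-E : ∀ {n} (π : Permutation′ n) {u v} → E π u v ⇔ E (π ʳ) (ʳ-iso π ⟨$⟩ʳ u) (ʳ-iso π ⟨$⟩ʳ v)
ʳ-iso-E π = mk⇔
  (λ (u<v , p) → opposite-anti p , ≡.subst₂ _<_ (≡.sym (ʳ-iso-ˡ π _)) (≡.sym (ʳ-iso-ˡ π _)) (opposite-anti u<v))
  (λ (p , q) → opposite-anti⁻ (≡.subst₂ _<_ (ʳ-iso-ˡ π _) (ʳ-iso-ˡ π _) q) , opposite-anti⁻ p)

ʳ-iso-N : ∀ {n} (π : Permutation′ n) {u v} → N π u v → N (π ʳ) (ʳ-iso π ⟨$⟩ʳ v) (ʳ-iso π ⟨$⟩ʳ u)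
ʳ-iso-N π (u<v , p) = opposite-anti p , ≡.subst₂ _<_ (≡.sym (ʳ-iso-ˡ π _)) (≡.sym (ʳ-iso-ˡ π _)) (opposite-anti u<v)

ʳ-≅ᵈ : ∀ {n} (π : Permutation′ n) → D π ≅ᵈ D (π ʳ)
ʳ-≅ᵈ π = ʳ-iso π , λ u v → ʳ-iso-E π

-- Permutations with a prime inversion graph

module Prime {n} {π : Permutation′ n} (trivial-modules : OnlyTrivialModules G⟨ π ⟩) (root : IsPrimeRoot G⟨ π ⟩) where
  private
    G = G⟨ π ⟩
    1<n = proj₁ root

  -- A graph and its complement have the same modules, with the roles of all and none exchanged.
  -- Decidability of adjacency turns a non-edge of the complement back into an edge.
  complement-trivial-modules : OnlyTrivialModules (complement G)
  complement-trivial-modules M (nonempty , homogeneous) = trivial-modules M (nonempty , λ v v∉M →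
    [ (λ all → inj₂ λ m m∈M → proj₂ (all m m∈M))
    , (λ none → inj₁ λ m m∈M → decidable-stable (adj? π v m) λ ¬e →
        none m m∈M ((λ { ≡.refl → v∉M m∈M }) , ¬e)) ]′ (homogeneous v v∉M))

  complement-adj? : Decidable (Adj (complement G))
  complement-adj? u v = ¬? (u Fin.≟ v) ×-dec ¬? (adj? π u v)

  complement²-connected : Connected (complement (complement G))
  complement²-connected u v = Star.map {T = Adj G}
    (λ { {x} {y} e → (λ { ≡.refl → SimpleGraph.irrefl G ≡.refl e }) , λ (_ , ¬e) → ¬e e }) (proj₁ (proj₂ root) u v)

  -- On two vertices the same pair would have to be an edge both of `G` and of its complement. The
  -- bound is what makes `a` and `b` recognisable in `K₂ n`.
  3≤n : 3 ℕ.≤ n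
  3≤n = go {H = G} 1<n (proj₁ (proj₂ root)) (proj₂ (proj₂ root)) (adj? π)
    where
    first-step : ∀ {R : Rel (Fin 2) 0ℓ} → (∀ {x} → ¬ R x x) → Star R 0F 1F → R 0F 1F
    first-step irr (_◅_ {j = 0F} r p) = contradiction r irr
    first-step irr (_◅_ {j = 1F} r p) = r

    go : ∀ {m} {H : SimpleGraph (Fin m)} → 1 ℕ.< m → Connected H → Connected (complement H) → Decidable (Adj H) → 3 ℕ.≤ m
    go {1} (s≤s ()) _ _ _
    go {2} {H} _ c cᶜ _ = contradiction (first-step (SimpleGraph.irrefl H ≡.refl) (c 0F 1F))
      (proj₂ (first-step {Adj (complement H)} (λ (≢ , _) → ≢ ≡.refl) (cᶜ 0F 1F)))
    go {2+ (ℕ.suc m)} _ _ _ _ = s≤s (s≤s (s≤s z≤n))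

  orientation-unique : ∀ {F} → IsTransitiveOrientation G F → F ≅ᵈ D π ⊎ F ≅ᵈ (D π ᵒ)
  orientation-unique F-to = Sum.map ⇔⇒≅ᵈ ⇔⇒≅ᵈ
    (Comparison.unique-orientation (adj? π) F-to (E-orientation π) trivial-modules 1<n (proj₂ (proj₂ root)))

  -- Carried over by `f`, the non-inversions of `σ` form a second transitive orientation of the
  -- complement of `G`, so they are `N π` or its reverse. Then `order-rigid` applies to `f` itself,
  -- or to `f` followed by `ʳ-iso π`, which reverses `N π` and keeps `E π`.
  ≅ᵈ⇒≈ : ∀ {σ} → D σ ≅ᵈ D π → σ ≈ₚ π ⊎ σ ≈ₚ π ʳ
  ≅ᵈ⇒≈ {σ} (f , Eσ⇔Eπ) = Sum.map same reversed
    (Comparison.unique-orientation complement-adj? (N-orientation π) Nσ-orientation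
      complement-trivial-modules 1<n complement²-connected)
    where
    Nσ : Digraph n
    Nσ u v = N σ (f ⟨$⟩ˡ u) (f ⟨$⟩ˡ v)

    edge⇒ : ∀ {u v} → Adj G⟨ σ ⟩ (f ⟨$⟩ˡ u) (f ⟨$⟩ˡ v) → Adj G u v
    edge⇒ = Sum.map back back
      where
      back : ∀ {u v} → E σ (f ⟨$⟩ˡ u) (f ⟨$⟩ˡ v) → E π u v
      back e = ≡.subst₂ (E π) (inverseʳ f) (inverseʳ f) (to (Eσ⇔Eπ _ _) e)

    edge⇐ : ∀ {u v} → Adj G u v → Adj G⟨ σ ⟩ (f ⟨$⟩ˡ u) (f ⟨$⟩ˡ v)
    edge⇐ = Sum.map forth forth
      where
      forth : ∀ {u v} → E π u v → E σ (f ⟨$⟩ˡ u) (f ⟨$⟩ˡ v)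
      forth e = from (Eσ⇔Eπ _ _) (≡.subst₂ (E π) (≡.sym (inverseʳ f)) (≡.sym (inverseʳ f)) e)

    Nσ-orientation : IsTransitiveOrientation (complement G) Nσ
    Nσ-orientation = pullback (N-orientation σ) (f ⟨$⟩ˡ_)
      (λ (u≢v , ¬e) → u≢v ∘ injectiveˡ f , ¬e ∘ edge⇒)
      (λ (u≢v , ¬e) → u≢v ∘ ≡.cong (f ⟨$⟩ˡ_) , ¬e ∘ edge⇐)

    N⇒Nσ : ∀ {u v} → N σ u v → Nσ (f ⟨$⟩ʳ u) (f ⟨$⟩ʳ v)
    N⇒Nσ = ≡.subst₂ (N σ) (≡.sym (inverseˡ f)) (≡.sym (inverseˡ f))

    same : (∀ {u v} → N π u v ⇔ Nσ u v) → σ ≈ₚ π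
    same Nπ⇔Nσ = order-rigid {σ = σ} {π} f (to (Eσ⇔Eπ _ _)) (from Nπ⇔Nσ ∘ N⇒Nσ)

    reversed : (∀ {u v} → N π u v ⇔ Nσ v u) → σ ≈ₚ π ʳ
    reversed Nπ⇔Nσ = order-rigid {σ = σ} {π ʳ} (f ∘ₚ ʳ-iso π)
      (to (ʳ-iso-E π) ∘ to (Eσ⇔Eπ _ _)) (ʳ-iso-N π ∘ from Nπ⇔Nσ ∘ N⇒Nσ)

  ≅±⇒≈ : ∀ {σ} → σ ≅± π → σ ≈ₚ π ⊎ σ ≈ₚ flip π ⊎ σ ≈ₚ π ʳ ⊎ σ ≈ₚ flip (π ʳ)
  ≅±⇒≈ {σ} (inj₁ i) = [ inj₁ , inj₂ ∘ inj₂ ∘ inj₁ ]′ (≅ᵈ⇒≈ {σ} i)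
  -- Inverting `σ` reverses its digraph, so `flip σ` falls under the unreversed case.
  ≅±⇒≈ {σ} (inj₂ i) = [ (λ e → inj₂ (inj₁ (≈⇒≈ˡ (flip σ) π e)))
                      , (λ e → inj₂ (inj₂ (inj₂ (≈⇒≈ˡ (flip σ) (π ʳ) e)))) ]′
    (≅ᵈ⇒≈ {flip σ} (≅ᵈ-trans (D (flip σ)) (D σ ᵒ) (D π) (flip-≅ᵈ σ) (≅ᵈ-ᵒ (D σ) (D π ᵒ) i)))

≅±-flip : ∀ {n} (π : Permutation′ n) → flip π ≅± π
≅±-flip π = inj₂ (flip-≅ᵈ π)

≅±-ʳ : ∀ {n} (π : Permutation′ n) → (π ʳ) ≅± π
≅±-ʳ π = inj₁ (≅ᵈ-sym (D π) (D (π ʳ)) (ʳ-≅ᵈ π))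

class⇒≅± : ∀ {n} {σ π : Permutation′ n} → σ ≈ₚ π ⊎ σ ≈ₚ flip π ⊎ σ ≈ₚ π ʳ ⊎ σ ≈ₚ flip (π ʳ) → σ ≅± π
class⇒≅± {σ = σ} {π} (inj₁ e)               = ≈⇒≅± σ π e
class⇒≅± {σ = σ} {π} (inj₂ (inj₁ e))        = ≅±-trans σ (flip π) π (≈⇒≅± σ (flip π) e) (≅±-flip π)
class⇒≅± {σ = σ} {π} (inj₂ (inj₂ (inj₁ e))) = ≅±-trans σ (π ʳ) π (≈⇒≅± σ (π ʳ) e) (≅±-ʳ π)
class⇒≅± {σ = σ} {π} (inj₂ (inj₂ (inj₂ e))) = ≅±-trans σ (flip (π ʳ)) π (≈⇒≅± σ (flip (π ʳ)) e)
  (≅±-trans (flip (π ʳ)) (π ʳ) π (≅±-flip (π ʳ)) (≅±-ʳ π))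

-- Ordered fields

-- Ring identities with integer coefficients. The integer p - q is represented by the pair (p , q).
module IntegerCoefficients {c ℓ} (R : CommutativeRing c ℓ) where
  open CommutativeRing R
  open Mult semiring using (×-homo-+; ×1-homo-*) renaming (_×_ to _⊠_)
  open SetoidReasoning setoid
  open RingProperties ring using (-0#≈0#; -‿distribˡ-*; -‿distribʳ-*; -‿involutive)
  open AbelianGroupProperties +-abelianGroup using () renaming (⁻¹-∙-comm to -‿+-comm)

  -- The solver compares normal forms syntactically, so coefficients must be kept reduced.
  reduce : ℕ → ℕ → ℕ × ℕ
  reduce (ℕ.suc p) (ℕ.suc q) = reduce p q
  reduce p         q         = p , q

  Coefficient : RawRing 0ℓ 0ℓ
  Coefficient = record
    { Carrier = ℕ × ℕ
    ; _≈_     = _≡_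
    ; _+_     = λ (p , q) (p′ , q′) → reduce (p ℕ.+ p′) (q ℕ.+ q′)
    ; _*_     = λ (p , q) (p′ , q′) → reduce (p ℕ.* p′ ℕ.+ q ℕ.* q′) (p ℕ.* q′ ℕ.+ q ℕ.* p′)
    ; -_      = λ (p , q) → q , p
    ; 0#      = 0 , 0
    ; 1#      = 1 , 0
    }

  -- The first two clauses make 0# and 1# evaluate to themselves.
  ⟦_⟧ : ℕ × ℕ → Carrier
  ⟦ 0 , 0 ⟧ = 0#
  ⟦ 1 , 0 ⟧ = 1#
  ⟦ p , q ⟧ = p ⊠ 1# - q ⊠ 1#

  ⟦⟧-difference : ∀ p q → ⟦ p , q ⟧ ≈ p ⊠ 1# - q ⊠ 1#
  ⟦⟧-difference 0       0       = sym (trans (+-congˡ -0#≈0#) (+-identityʳ 0#))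
  ⟦⟧-difference 0       (ℕ.suc q) = refl
  ⟦⟧-difference 1       0       = sym (trans (+-congˡ -0#≈0#) (trans (+-identityʳ _) (+-identityʳ _)))
  ⟦⟧-difference 1       (ℕ.suc q) = refl
  ⟦⟧-difference (ℕ.2+ p) q = refl

  private
    interchange : ∀ w x y z → (w + x) + (y + z) ≈ (w + y) + (x + z)
    interchange w x y z = begin
      (w + x) + (y + z)  ≈⟨ +-assoc w x (y + z) ⟩
      w + (x + (y + z))  ≈⟨ +-congˡ (trans (sym (+-assoc x y z)) (trans (+-congʳ (+-comm x y)) (+-assoc y x z))) ⟩
      w + (y + (x + z))  ≈⟨ +-assoc w y (x + z) ⟨
      (w + y) + (x + z)  ∎

    -‿interchange : ∀ w x y z → (w + x) - (y + z) ≈ (w - y) + (x - z)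
    -‿interchange w x y z = trans (+-congˡ (sym (-‿+-comm y z))) (interchange w x (- y) (- z))

    expand-* : ∀ w x y z → (w - x) * (y - z) ≈ (w * y + x * z) - (w * z + x * y)
    expand-* w x y z = begin
      (w - x) * (y - z)                              ≈⟨ distribʳ (y - z) w (- x) ⟩
      w * (y - z) + - x * (y - z)                    ≈⟨ +-cong (distribˡ w y (- z)) (distribˡ (- x) y (- z)) ⟩
      (w * y + w * - z) + (- x * y + - x * - z)      ≈⟨ +-cong (+-congˡ (sym (-‿distribʳ-* w z)))
                                                         (+-cong (sym (-‿distribˡ-* x y)) -x*-z) ⟩
      (w * y - w * z) + (- (x * y) + x * z)          ≈⟨ +-congˡ (+-comm _ _) ⟩
      (w * y - w * z) + (x * z - x * y)              ≈⟨ -‿interchange _ _ _ _ ⟨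
      (w * y + x * z) - (w * z + x * y)              ∎
      where
      -x*-z : - x * - z ≈ x * z
      -x*-z = trans (sym (-‿distribˡ-* x (- z))) (trans (-‿cong (sym (-‿distribʳ-* x z))) (-‿involutive _))

    cancel : ∀ x y z → (x + z) - (y + z) ≈ x - y
    cancel x y z = trans (-‿interchange x z y z) (trans (+-congˡ (-‿inverseʳ z)) (+-identityʳ _))

  reduce-correct : ∀ p q → ⟦ reduce p q ⟧ ≈ p ⊠ 1# - q ⊠ 1#
  reduce-correct 0         q         = ⟦⟧-difference 0 q
  reduce-correct (ℕ.suc p) 0         = ⟦⟧-difference (ℕ.suc p) 0
  reduce-correct (ℕ.suc p) (ℕ.suc q) = begin
    ⟦ reduce p q ⟧                     ≈⟨ reduce-correct p q ⟩
    p ⊠ 1# - q ⊠ 1#                    ≈⟨ cancel _ _ _ ⟨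
    (p ⊠ 1# + 1#) - (q ⊠ 1# + 1#)      ≈⟨ +-cong (+-comm _ _) (-‿cong (+-comm _ _)) ⟩
    ℕ.suc p ⊠ 1# - ℕ.suc q ⊠ 1#        ∎

  morphism : Coefficient -Raw-AlmostCommutative⟶ fromCommutativeRing R
  morphism = record
    { ⟦_⟧    = ⟦_⟧
    ; +-homo = λ (p , q) (p′ , q′) → begin
        ⟦ reduce (p ℕ.+ p′) (q ℕ.+ q′) ⟧                           ≈⟨ reduce-correct (p ℕ.+ p′) (q ℕ.+ q′) ⟩
        (p ℕ.+ p′) ⊠ 1# - (q ℕ.+ q′) ⊠ 1#                  ≈⟨ +-cong (×-homo-+ 1# p p′) (-‿cong (×-homo-+ 1# q q′)) ⟩
        (p ⊠ 1# + p′ ⊠ 1#) - (q ⊠ 1# + q′ ⊠ 1#)            ≈⟨ -‿interchange _ _ _ _ ⟩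
        (p ⊠ 1# - q ⊠ 1#) + (p′ ⊠ 1# - q′ ⊠ 1#)            ≈⟨ +-cong (⟦⟧-difference p q) (⟦⟧-difference p′ q′) ⟨
        ⟦ p , q ⟧ + ⟦ p′ , q′ ⟧                            ∎
    ; *-homo = λ (p , q) (p′ , q′) → begin
        ⟦ reduce (p ℕ.* p′ ℕ.+ q ℕ.* q′) (p ℕ.* q′ ℕ.+ q ℕ.* p′) ⟧
          ≈⟨ reduce-correct (p ℕ.* p′ ℕ.+ q ℕ.* q′) (p ℕ.* q′ ℕ.+ q ℕ.* p′) ⟩
        (p ℕ.* p′ ℕ.+ q ℕ.* q′) ⊠ 1# - (p ℕ.* q′ ℕ.+ q ℕ.* p′) ⊠ 1#
          ≈⟨ +-cong (sum-of-products p p′ q q′) (-‿cong (sum-of-products p q′ q p′)) ⟩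
        (p ⊠ 1# * (p′ ⊠ 1#) + q ⊠ 1# * (q′ ⊠ 1#)) - (p ⊠ 1# * (q′ ⊠ 1#) + q ⊠ 1# * (p′ ⊠ 1#))
          ≈⟨ expand-* _ _ _ _ ⟨
        (p ⊠ 1# - q ⊠ 1#) * (p′ ⊠ 1# - q′ ⊠ 1#)            ≈⟨ *-cong (⟦⟧-difference p q) (⟦⟧-difference p′ q′) ⟨
        ⟦ p , q ⟧ * ⟦ p′ , q′ ⟧                            ∎
    ; -‿homo = λ (p , q) → begin
        ⟦ q , p ⟧                  ≈⟨ ⟦⟧-difference q p ⟩
        q ⊠ 1# - p ⊠ 1#            ≈⟨ +-comm _ _ ⟩
        - (p ⊠ 1#) + q ⊠ 1#        ≈⟨ +-congˡ (-‿involutive _) ⟨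
        - (p ⊠ 1#) + - - (q ⊠ 1#)  ≈⟨ -‿+-comm _ _ ⟩
        - (p ⊠ 1# - q ⊠ 1#)        ≈⟨ -‿cong (⟦⟧-difference p q) ⟨
        - ⟦ p , q ⟧                ∎
    ; 0-homo = refl
    ; 1-homo = refl
    }
    where
    sum-of-products : ∀ k l m n → (k ℕ.* l ℕ.+ m ℕ.* n) ⊠ 1# ≈ k ⊠ 1# * (l ⊠ 1#) + m ⊠ 1# * (n ⊠ 1#)
    sum-of-products k l m n =
      trans (×-homo-+ 1# (k ℕ.* l) (m ℕ.* n)) (+-cong (×1-homo-* k l) (×1-homo-* m n))

  ⟦⟧-≟ : WeaklyDecidable (Induced-equivalence morphism)
  ⟦⟧-≟ x y with Product.≡-dec ℕ._≟_ ℕ._≟_ x y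
  ... | no  _   = nothing
  ... | yes x≡y = just (reflexive (≡.cong ⟦_⟧ x≡y))

  open RingSolver Coefficient (fromCommutativeRing R) morphism ⟦⟧-≟ public
    using (Polynomial; solve; _:=_; con; _:+_; _:*_; _:-_; :-_)

  :0 :1 : ∀ {n} → Polynomial n
  :0 = con (0 , 0)
  :1 = con (1 , 0)

module OrderedFieldProperties {c ℓ₁ ℓ₂} (𝔽 : OrderedField c ℓ₁ ℓ₂) where
  open OrderedField 𝔽
  open IsStrictTotalOrder isStrictTotalOrder public
    using (<-resp-≈; compare) renaming (trans to <-trans; irrefl to <-irrefl)
  open IntegerCoefficients commutativeRing public
  open Mult semiring public using (×-homo-+; ×1-homo-*) renaming (_×_ to _⊠_)

  abstract

    <-respʳ : ∀ {x y z} → y ≈ z → x <ᶠ y → x <ᶠ z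
    <-respʳ = proj₁ <-resp-≈

    <-respˡ : ∀ {x y z} → y ≈ z → y <ᶠ x → z <ᶠ x
    <-respˡ = proj₂ <-resp-≈

    0≮0 : ∀ {x} → x ≈ 0# → ¬ 0# <ᶠ x
    0≮0 x≈0 0<x = <-irrefl (sym x≈0) 0<x

    +-pos : ∀ {x y} → 0# <ᶠ x → 0# <ᶠ y → 0# <ᶠ x + y
    +-pos {x} {y} 0<x 0<y = <-trans 0<y (<-respˡ (+-identityˡ y) (+-monoˡ-< y 0<x))

    <⇒0<- : ∀ {x y} → x <ᶠ y → 0# <ᶠ y - x
    <⇒0<- {x} {y} x<y = <-respˡ (-‿inverseʳ x) (+-monoˡ-< (- x) x<y)

    0<-⇒< : ∀ {x y} → 0# <ᶠ y - x → x <ᶠ y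
    0<-⇒< {x} {y} p = <-respˡ (+-identityˡ x)
      (<-respʳ (solve 2 (λ x y → (y :- x) :+ x := y) refl x y) (+-monoˡ-< x p))

    neg-pos : ∀ {x} → x <ᶠ 0# → 0# <ᶠ - x
    neg-pos {x} x<0 = <-respʳ (+-identityˡ (- x)) (<⇒0<- x<0)

    *-pos⁻ : ∀ {x y} → 0# <ᶠ x → 0# <ᶠ x * y → 0# <ᶠ y
    *-pos⁻ {x} {y} 0<x 0<xy with compare 0# y
    ... | tri< 0<y _ _ = 0<y
    ... | tri≈ _ 0≈y _ = contradiction 0<xy (0≮0 (trans (*-congˡ (sym 0≈y)) (zeroʳ x)))
    ... | tri> _ _ y<0 = contradiction (+-pos 0<xy (*-pos 0<x (neg-pos y<0)))
      (0≮0 (solve 2 (λ x y → x :* y :+ x :* :- y := :0) refl x y))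

    square-pos : ∀ {x} → ¬ x ≈ 0# → 0# <ᶠ x * x
    square-pos {x} x≉0 with compare 0# x
    ... | tri< 0<x _ _ = *-pos 0<x 0<x
    ... | tri≈ _ 0≈x _ = contradiction (sym 0≈x) x≉0
    ... | tri> _ _ x<0 = <-respʳ (solve 1 (λ x → (:- x) :* (:- x) := x :* x) refl x) (*-pos (neg-pos x<0) (neg-pos x<0))

  infix 4 _∥_

  -- Both arguments are nonzero and have the same sign. Comparing signs, instead of fixing them,
  -- treats the two sides of the line `ab` at once.
  _∥_ : Rel Carrier ℓ₂
  x ∥ y = 0# <ᶠ x * y

  abstract

    ∥-cong : ∀ {x x′ y y′} → x ≈ x′ → y ≈ y′ → x ∥ y → x′ ∥ y′
    ∥-cong x≈x′ y≈y′ = <-respʳ (*-cong x≈x′ y≈y′)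

    ∥-sym : ∀ {x y} → x ∥ y → y ∥ x
    ∥-sym = <-respʳ (*-comm _ _)

    ∥-nonzeroʳ : ∀ {x y} → x ∥ y → ¬ y ≈ 0#
    ∥-nonzeroʳ x∥y y≈0 = 0≮0 (trans (*-congˡ y≈0) (zeroʳ _)) x∥y

    ∥-nonzeroˡ : ∀ {x y} → x ∥ y → ¬ x ≈ 0#
    ∥-nonzeroˡ = ∥-nonzeroʳ ∘ ∥-sym

    ∥-trans : ∀ {x y z} → x ∥ y → y ∥ z → x ∥ z
    ∥-trans {x} {y} {z} x∥y y∥z = *-pos⁻ (square-pos (∥-nonzeroʳ x∥y))
      (<-respʳ (solve 3 (λ x y z → (x :* y) :* (y :* z) := (y :* y) :* (x :* z)) refl x y z) (*-pos x∥y y∥z))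

    ∥-refl : ∀ {x} → ¬ x ≈ 0# → x ∥ x
    ∥-refl = square-pos

    ∥-+ : ∀ {x y z} → x ∥ y → x ∥ z → x ∥ (y + z)
    ∥-+ {x} {y} {z} x∥y x∥z = <-respʳ (sym (distribˡ x y z)) (+-pos x∥y x∥z)

    ∥-neg : ∀ {x y} → x ∥ y → ¬ x ∥ - y
    ∥-neg {x} {y} x∥y x∥-y = 0≮0 (solve 2 (λ x y → x :* y :+ x :* :- y := :0) refl x y) (+-pos x∥y x∥-y)

    ∥-negate : ∀ {x y} → x ∥ y → - x ∥ - y
    ∥-negate {x} {y} = <-respʳ (solve 2 (λ x y → x :* y := (:- x) :* (:- y)) refl x y)

    ∥-scale : ∀ {t x} → 0# <ᶠ t → ¬ x ≈ 0# → x ∥ t * x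
    ∥-scale {t} {x} 0<t x≉0 = <-respʳ (solve 2 (λ t x → t :* (x :* x) := x :* (t :* x)) refl t x) (*-pos 0<t (square-pos x≉0))

    ∥-scaled : ∀ {s t x y} → 0# <ᶠ s → 0# <ᶠ t → ¬ y ≈ 0# → s * x ≈ t * y → y ∥ x
    ∥-scaled {s} {t} {x} {y} 0<s 0<t y≉0 sx≈ty = *-pos⁻ 0<s
      (<-respʳ (trans (*-congˡ (sym sx≈ty)) (solve 3 (λ s x y → y :* (s :* x) := s :* (y :* x)) refl s x y)) (∥-scale 0<t y≉0))

    ⊠-pos : ∀ n → 0# <ᶠ ℕ.suc n ⊠ 1#
    ⊠-pos 0         = <-respʳ (sym (+-identityʳ 1#)) 0<1
    ⊠-pos (ℕ.suc n) = +-pos 0<1 (⊠-pos n)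

    ⊠-mono : ∀ {m n} → m ℕ.< n → m ⊠ 1# <ᶠ n ⊠ 1#
    ⊠-mono {0}       {ℕ.suc n} _         = ⊠-pos n
    ⊠-mono {ℕ.suc m} {ℕ.suc n} (s≤s m<n) =
      <-respˡ (+-comm _ _) (<-respʳ (+-comm _ _) (+-monoˡ-< 1# (⊠-mono m<n)))

    ⊠-injective : ∀ {m n} → m ⊠ 1# ≈ n ⊠ 1# → m ≡ n
    ⊠-injective {m} {n} eq with ℕ.<-cmp m n
    ... | tri< m<n _ _ = contradiction (⊠-mono m<n) (<-irrefl eq)
    ... | tri≈ _ m≡n _ = m≡n
    ... | tri> _ _ n<m = contradiction (⊠-mono n<m) (<-irrefl (sym eq))

-- Plane geometry

module GeometryProperties {c ℓ₁ ℓ₂} (𝔽 : OrderedField c ℓ₁ ℓ₂) where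
  open OrderedField 𝔽
  open OrderedFieldProperties 𝔽
  open Geometry 𝔽
  open SetoidReasoning setoid
  open RingProperties ring using (-0#≈0#; -‿involutive)

  -- Syntactic counterparts of the operations on points, used to state determinant identities for
  -- the ring solver.
  :Point : ℕ → Set
  :Point n = Polynomial n × Polynomial n

  :det : ∀ {n} → :Point n → :Point n → Polynomial n
  :det (x , y) (x′ , y′) = x :* y′ :- y :* x′

  infixl 6 _:+ᵖ_ _:-ᵖ_
  infixr 7 _:·_

  _:+ᵖ_ _:-ᵖ_ : ∀ {n} → :Point n → :Point n → :Point n
  (x , y) :+ᵖ (x′ , y′) = x :+ x′ , y :+ y′
  (x , y) :-ᵖ (x′ , y′) = x :- x′ , y :- y′

  _:·_ : ∀ {n} → Polynomial n → :Point n → :Point n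
  t :· (x , y) = t :* x , t :* y

  abstract

    -ᵖ-cong : ∀ {p p′ q q′} → p ≈ᵖ p′ → q ≈ᵖ q′ → p -ᵖ q ≈ᵖ p′ -ᵖ q′
    -ᵖ-cong (e₁ , e₂) (e₁′ , e₂′) = +-cong e₁ (-‿cong e₁′) , +-cong e₂ (-‿cong e₂′)

    ≈ᵖ-refl : ∀ {p} → p ≈ᵖ p
    ≈ᵖ-refl = refl , refl

    ≈ᵖ-sym : ∀ {p q} → p ≈ᵖ q → q ≈ᵖ p
    ≈ᵖ-sym (e₁ , e₂) = sym e₁ , sym e₂

    ≈ᵖ-trans : ∀ {p q r} → p ≈ᵖ q → q ≈ᵖ r → p ≈ᵖ r
    ≈ᵖ-trans (e₁ , e₂) (e₁′ , e₂′) = trans e₁ e₁′ , trans e₂ e₂′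

    det-cong : ∀ {u u′ v v′} → u ≈ᵖ u′ → v ≈ᵖ v′ → det u v ≈ det u′ v′
    det-cong (e₁ , e₂) (e₁′ , e₂′) = +-cong (*-cong e₁ e₂′) (-‿cong (*-cong e₂ e₁′))

    det-self : ∀ u → det u u ≈ 0#
    det-self (x , y) = solve 2 (λ x y → :det (x , y) (x , y) := :0) refl x y

    det-swap : ∀ u v → det u v ≈ - det v u
    det-swap (x , y) (x′ , y′) =
      solve 4 (λ x y x′ y′ → :det (x , y) (x′ , y′) := :- :det (x′ , y′) (x , y)) refl x y x′ y′

    det-scaleˡ : ∀ t u v → det (t ·ᵖ u) v ≈ t * det u v
    det-scaleˡ t (x , y) (x′ , y′) = solve 5 (λ t x y x′ y′ →
      :det (t :· (x , y)) (x′ , y′) := t :* :det (x , y) (x′ , y′)) refl t x y x′ y′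

    det-scaleʳ : ∀ t u v → det u (t ·ᵖ v) ≈ t * det u v
    det-scaleʳ t (x , y) (x′ , y′) = solve 5 (λ t x y x′ y′ →
      :det (x , y) (t :· (x′ , y′)) := t :* :det (x , y) (x′ , y′)) refl t x y x′ y′

    det-scale : ∀ {s t u v u′ v′} → s ·ᵖ u ≈ᵖ u′ → t ·ᵖ v ≈ᵖ v′ → s * t * det u v ≈ det u′ v′
    det-scale {s} {t} {u} {v} {u′} {v′} e e′ = begin
      s * t * det u v          ≈⟨ *-assoc s t _ ⟩
      s * (t * det u v)        ≈⟨ *-congˡ (det-scaleʳ t u v) ⟨
      s * det u (t ·ᵖ v)       ≈⟨ det-scaleˡ s u (t ·ᵖ v) ⟨
      det (s ·ᵖ u) (t ·ᵖ v)    ≈⟨ det-cong e e′ ⟩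
      det u′ v′                ∎

    det-negate : ∀ u v w → det (u -ᵖ v) w ≈ - det (v -ᵖ u) w
    det-negate (u₁ , u₂) (v₁ , v₂) (w₁ , w₂) = solve 6 (λ u₁ u₂ v₁ v₂ w₁ w₂ →
      let u = u₁ , u₂ ; v = v₁ , v₂ ; w = w₁ , w₂ in
      :det (u :-ᵖ v) w := :- :det (v :-ᵖ u) w) refl u₁ u₂ v₁ v₂ w₁ w₂

    displacement : ∀ {O v p} → p ≈ᵖ O +ᵖ v → v ≈ᵖ p -ᵖ O
    displacement {o₁ , o₂} {v₁ , v₂} (e₁ , e₂) =
      trans (cancel o₁ v₁) (+-congʳ (sym e₁)) , trans (cancel o₂ v₂) (+-congʳ (sym e₂))
      where
      cancel : ∀ o v → v ≈ (o + v) - o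
      cancel = solve 2 (λ o v → v := (o :+ v) :- o) refl

    interior-flip : ∀ q r X → InteriorOf q r X → InteriorOf r q X
    interior-flip (q₁ , q₂) (r₁ , r₂) X (t , 0<t , t<1 , e₁ , e₂) = 1# - t , <⇒0<- t<1
      , 0<-⇒< (<-respʳ (solve 1 (λ t → t := :1 :- (:1 :- t)) refl t) 0<t)
      , trans e₁ (reparametrise q₁ r₁) , trans e₂ (reparametrise q₂ r₂)
      where
      reparametrise : ∀ q r → q + t * (r - q) ≈ r + (1# - t) * (q - r)
      reparametrise q r = solve 3 (λ q r t → q :+ t :* (r :- q) := r :+ (:1 :- t) :* (q :- r)) refl q r t

    -- Since X = A + s (p - A) = B + t (q - B), taking the determinant of X - B with p - B gives
    -- t det (p - B) (q - B) = (1 - s) det (B - A) (p - A).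
    crossing⇒turn : ∀ A B p q {X} → InteriorOf A p X → InteriorOf B q X →
                    ¬ det (B -ᵖ A) (p -ᵖ A) ≈ 0# → det (B -ᵖ A) (p -ᵖ A) ∥ det (p -ᵖ B) (q -ᵖ B)
    crossing⇒turn A@(a₁ , a₂) B@(b₁ , b₂) p@(p₁ , p₂) q {X} (s , 0<s , s<1 , X≈₁) (t , 0<t , t<1 , X≈₂) h≉0 =
      ∥-scaled 0<t (<⇒0<- s<1) h≉0 (begin
        t * det (p -ᵖ B) (q -ᵖ B)                     ≈⟨ det-scaleʳ t (p -ᵖ B) (q -ᵖ B) ⟨
        det (p -ᵖ B) (t ·ᵖ (q -ᵖ B))                  ≈⟨ det-cong ≈ᵖ-refl (≈ᵖ-trans (displacement X≈₂) (-ᵖ-cong X≈₁ ≈ᵖ-refl)) ⟩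
        det (p -ᵖ B) ((A +ᵖ s ·ᵖ (p -ᵖ A)) -ᵖ B)      ≈⟨ solve 7 (λ a₁ a₂ b₁ b₂ p₁ p₂ s →
          let A = a₁ , a₂ ; B = b₁ , b₂ ; p = p₁ , p₂ in
          :det (p :-ᵖ B) ((A :+ᵖ s :· (p :-ᵖ A)) :-ᵖ B) := (:1 :- s) :* :det (B :-ᵖ A) (p :-ᵖ A)) refl a₁ a₂ b₁ b₂ p₁ p₂ s ⟩
        (1# - s) * det (B -ᵖ A) (p -ᵖ A)              ∎)

    -- Two segments from `O` through a common interior point have proportional directions, so the
    -- determinant vanishes. The free `h` lets this refute any comparison of that determinant with a
    -- height.
    common-origin : ∀ O p q {X h} → InteriorOf O p X → InteriorOf O q X → ¬ h ∥ det (p -ᵖ O) (q -ᵖ O)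
    common-origin O p q {X} (s , 0<s , _ , X≈₁) (t , 0<t , _ , X≈₂) h∥det =
      ∥-nonzeroʳ (∥-scale (*-pos 0<s 0<t) (∥-nonzeroʳ h∥det)) (begin
        s * t * det (p -ᵖ O) (q -ᵖ O)                 ≈⟨ det-scale (displacement X≈₁) (displacement X≈₂) ⟩
        det (X -ᵖ O) (X -ᵖ O)                         ≈⟨ det-self _ ⟩
        0#                                            ∎)

    -- Here `e` is the inverse of `d`. If `x` and `d - x` have the same sign, their sum `d` has it
    -- too, so both quotients by `d` are positive, and they add up to 1.
    fraction : ∀ {d e x} → d * e ≈ 1# → x ∥ (d - x) → 0# <ᶠ x * e × x * e <ᶠ 1#
    fraction {d} {e} {x} de≈1 x∥d-x = ∥-trans x∥d d∥e , 0<-⇒< (<-respʳ (begin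
      (d - x) * e    ≈⟨ solve 3 (λ d e x → (d :- x) :* e := d :* e :- x :* e) refl d e x ⟩
      d * e - x * e  ≈⟨ +-congʳ de≈1 ⟩
      1# - x * e     ∎) (∥-trans (∥-trans (∥-sym x∥d-x) x∥d) d∥e))
      where
      d∥e : d ∥ e
      d∥e = <-respʳ (sym de≈1) 0<1

      x∥d : x ∥ d
      x∥d = ∥-cong refl (solve 2 (λ d x → (d :- x) :+ x := d) refl d x) (∥-+ x∥d-x (∥-refl (∥-nonzeroˡ x∥d-x)))

    det-baseᵇ : ∀ A B p → det (B -ᵖ A) (p -ᵖ B) ≈ det (B -ᵖ A) (p -ᵖ A)
    det-baseᵇ (a₁ , a₂) (b₁ , b₂) (p₁ , p₂) = solve 6 (λ a₁ a₂ b₁ b₂ p₁ p₂ →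
      let A = a₁ , a₂ ; B = b₁ , b₂ ; p = p₁ , p₂ in
      :det (B :-ᵖ A) (p :-ᵖ B) := :det (B :-ᵖ A) (p :-ᵖ A)) refl a₁ a₂ b₁ b₂ p₁ p₂

    -- Cramer's rule for A + s (p - A) = B + t (q - B), whose determinant is d below.
    turns⇒crossing : ∀ A B p q → let w = B -ᵖ A in
                     det w (p -ᵖ A) ∥ det w (q -ᵖ A) →
                     det w (p -ᵖ A) ∥ det (p -ᵖ B) (q -ᵖ B) → det w (q -ᵖ A) ∥ det (p -ᵖ A) (q -ᵖ A) →
                     ∃[ X ] InteriorOf A p X × InteriorOf B q X
    turns⇒crossing A@(a₁ , a₂) B@(b₁ , b₂) p@(p₁ , p₂) q@(q₁ , q₂) hp∥hq hp∥turn hq∥turn =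
      A +ᵖ (hq * e) ·ᵖ (p -ᵖ A)
      , (hq * e , proj₁ s-bounds , proj₂ s-bounds , ≈ᵖ-refl)
      , (hp * e , proj₁ t-bounds , proj₂ t-bounds
        , meet (p₁ - a₁) (q₁ - b₁) a₁ b₁ cramer₁ , meet (p₂ - a₂) (q₂ - b₂) a₂ b₂ cramer₂)
      where
      d hp hq : Carrier
      d  = det (p -ᵖ A) (q -ᵖ B)
      hp = det (B -ᵖ A) (p -ᵖ A)
      hq = det (B -ᵖ A) (q -ᵖ A)

      -- The difference `d - hp` is the determinant of the turn from `p` to `q` at `A`, and `d - hq`
      -- is that at `B`. The hypotheses on the turns thus become the bounds on the parameters
      -- `hp * e` and `hq * e`.
      hp∥d-hp : hp ∥ (d - hp)
      hp∥d-hp = ∥-cong refl (solve 8 (λ a₁ a₂ b₁ b₂ p₁ p₂ q₁ q₂ →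
        let A = a₁ , a₂ ; B = b₁ , b₂ ; p = p₁ , p₂ ; q = q₁ , q₂ in
        :det (p :-ᵖ A) (q :-ᵖ A) := :det (p :-ᵖ A) (q :-ᵖ B) :- :det (B :-ᵖ A) (p :-ᵖ A))
        refl a₁ a₂ b₁ b₂ p₁ p₂ q₁ q₂) (∥-trans hp∥hq hq∥turn)

      hq∥d-hq : hq ∥ (d - hq)
      hq∥d-hq = ∥-cong refl (solve 8 (λ a₁ a₂ b₁ b₂ p₁ p₂ q₁ q₂ →
        let A = a₁ , a₂ ; B = b₁ , b₂ ; p = p₁ , p₂ ; q = q₁ , q₂ in
        :det (p :-ᵖ B) (q :-ᵖ B) := :det (p :-ᵖ A) (q :-ᵖ B) :- :det (B :-ᵖ A) (q :-ᵖ A))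
        refl a₁ a₂ b₁ b₂ p₁ p₂ q₁ q₂) (∥-trans (∥-sym hp∥hq) hp∥turn)

      d≉0 : ¬ d ≈ 0#
      d≉0 = ∥-nonzeroʳ (∥-cong refl (solve 2 (λ d x → (d :- x) :+ x := d) refl d hp)
        (∥-+ hp∥d-hp (∥-refl (∥-nonzeroˡ hp∥d-hp))))

      e : Carrier
      e = proj₁ (inverse d d≉0)

      s-bounds : 0# <ᶠ hq * e × hq * e <ᶠ 1#
      s-bounds = fraction {e = e} (proj₂ (inverse d d≉0)) hq∥d-hq

      t-bounds : 0# <ᶠ hp * e × hp * e <ᶠ 1#
      t-bounds = fraction {e = e} (proj₂ (inverse d d≉0)) hp∥d-hp

      cramer₁ : hq * (p₁ - a₁) ≈ hp * (q₁ - b₁) + d * (b₁ - a₁)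
      cramer₁ = solve 8 (λ a₁ a₂ b₁ b₂ p₁ p₂ q₁ q₂ →
        let A = a₁ , a₂ ; B = b₁ , b₂ ; p = p₁ , p₂ ; q = q₁ , q₂ in
        :det (B :-ᵖ A) (q :-ᵖ A) :* (p₁ :- a₁) :=
        :det (B :-ᵖ A) (p :-ᵖ A) :* (q₁ :- b₁) :+ :det (p :-ᵖ A) (q :-ᵖ B) :* (b₁ :- a₁))
        refl a₁ a₂ b₁ b₂ p₁ p₂ q₁ q₂

      cramer₂ : hq * (p₂ - a₂) ≈ hp * (q₂ - b₂) + d * (b₂ - a₂)
      cramer₂ = solve 8 (λ a₁ a₂ b₁ b₂ p₁ p₂ q₁ q₂ →
        let A = a₁ , a₂ ; B = b₁ , b₂ ; p = p₁ , p₂ ; q = q₁ , q₂ in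
        :det (B :-ᵖ A) (q :-ᵖ A) :* (p₂ :- a₂) :=
        :det (B :-ᵖ A) (p :-ᵖ A) :* (q₂ :- b₂) :+ :det (p :-ᵖ A) (q :-ᵖ B) :* (b₂ :- a₂))
        refl a₁ a₂ b₁ b₂ p₁ p₂ q₁ q₂

      meet : ∀ u v o o′ → hq * u ≈ hp * v + d * (o′ - o) → o + hq * e * u ≈ o′ + hp * e * v
      meet u v o o′ cramer = begin
        o + hq * e * u                              ≈⟨ +-congˡ (solve 3 (λ h e u → h :* e :* u := e :* (h :* u)) refl hq e u) ⟩
        o + e * (hq * u)                            ≈⟨ +-congˡ (*-congˡ cramer) ⟩
        o + e * (hp * v + d * (o′ - o))             ≈⟨ solve 6 (λ d e h v o o′ →
          o :+ e :* (h :* v :+ d :* (o′ :- o)) := (o :+ h :* e :* v) :+ (d :* e) :* (o′ :- o)) refl d e hp v o o′ ⟩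
        (o + hp * e * v) + d * e * (o′ - o)         ≈⟨ +-congˡ (*-congʳ (proj₂ (inverse d d≉0))) ⟩
        (o + hp * e * v) + 1# * (o′ - o)            ≈⟨ solve 3 (λ o o′ m →
          (o :+ m) :+ :1 :* (o′ :- o) := o′ :+ m) refl o o′ (hp * e * v) ⟩
        o′ + hp * e * v                             ∎

  -- The part of a realization that determines its crossings.
  record RayConfiguration {n} (π : Permutation′ n) (pos : Vertex n → Point) : Set (c ⊔ ℓ₁ ⊔ ℓ₂) where
    A : Point
    A = pos a

    B : Point
    B = pos b

    base : Point
    base = B -ᵖ A

    field
      rayᵃ rayᵇ   : Fin n → Point
      same-side   : ∀ i j → SameSide base (rayᵃ i) (rayᵇ j)
      increasingᵃ : ∀ {i j} → i < j → SmallerAngle base (rayᵃ i) (rayᵃ j)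
      increasingᵇ : ∀ {i j} → i < j → SmallerAngle (A -ᵖ B) (rayᵇ i) (rayᵇ j)
      placedᵃ     : ∀ k → OnRay A (rayᵃ k) (pos (pt (π ⟨$⟩ʳ k)))
      placedᵇ     : ∀ k → OnRay B (rayᵇ k) (pos (pt k))

    P fromᵃ fromᵇ : Fin n → Point
    P i     = pos (pt i)
    fromᵃ i = P i -ᵖ A
    fromᵇ i = P i -ᵖ B

    -- Twice the signed area of the triangle formed by `a`, `b` and point `i`; its sign tells the
    -- side of the line `ab`.
    height : Fin n → Carrier
    height i = det base (fromᵃ i)

    private
      atᵃ : ∀ i → ∃[ t ] 0# <ᶠ t × t ·ᵖ rayᵃ (π ⟨$⟩ˡ i) ≈ᵖ fromᵃ i
      atᵃ i with placedᵃ (π ⟨$⟩ˡ i)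
      ... | t , 0<t , e = t , 0<t
        , displacement (≡.subst (λ j → pos (pt j) ≈ᵖ A +ᵖ t ·ᵖ rayᵃ (π ⟨$⟩ˡ i)) (inverseʳ π) e)

      atᵇ : ∀ i → ∃[ t ] 0# <ᶠ t × t ·ᵖ rayᵇ i ≈ᵖ fromᵇ i
      atᵇ i with placedᵇ i
      ... | t , 0<t , e = t , 0<t , displacement e

    abstract

      height∥rayᵃ : ∀ i → height i ∥ det base (rayᵃ (π ⟨$⟩ˡ i))
      height∥rayᵃ i with atᵃ i
      ... | t , 0<t , e = ∥-sym (∥-cong refl (trans (sym (det-scaleʳ t base (rayᵃ (π ⟨$⟩ˡ i)))) (det-cong ≈ᵖ-refl e))
        (∥-scale 0<t (∥-nonzeroˡ (same-side (π ⟨$⟩ˡ i) i))))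

      height∥rayᵇ : ∀ i → height i ∥ det base (rayᵇ i)
      height∥rayᵇ i with atᵇ i
      ... | t , 0<t , e = ∥-sym (∥-cong refl
        (trans (sym (det-scaleʳ t base (rayᵇ i))) (trans (det-cong ≈ᵖ-refl e) (det-baseᵇ A B (pos (pt i)))))
        (∥-scale 0<t (∥-nonzeroʳ (same-side (π ⟨$⟩ˡ i) i))))

      heights-agree : ∀ i j → height i ∥ height j
      heights-agree i j = ∥-trans (height∥rayᵃ i) (∥-trans (same-side _ j) (∥-sym (height∥rayᵇ j)))

      height≉0 : ∀ i → ¬ height i ≈ 0#
      height≉0 i = ∥-nonzeroˡ (heights-agree i i)

      turnᵃ : ∀ {i j} → (π ⟨$⟩ˡ i) < (π ⟨$⟩ˡ j) → height j ∥ det (fromᵃ i) (fromᵃ j)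
      turnᵃ {i} {j} i<j with atᵃ i | atᵃ j
      ... | s , 0<s , e | t , 0<t , e′ = ∥-trans (height∥rayᵃ j) (∥-trans (increasingᵃ i<j)
        (∥-cong refl (det-scale e e′) (∥-scale (*-pos 0<s 0<t) (∥-nonzeroʳ (increasingᵃ i<j)))))

      -- Angles at `b` are measured from the segment `ba` and grow in the opposite sense of
      -- rotation, so here the later ray comes first in the determinant.
      turnᵇ : ∀ {i j} → i < j → height j ∥ det (fromᵇ j) (fromᵇ i)
      turnᵇ {i} {j} i<j with atᵇ i | atᵇ j
      ... | s , 0<s , e | t , 0<t , e′ = ∥-trans (height∥rayᵇ j) (∥-trans flipped
        (∥-cong refl (det-scale e′ e) (∥-scale (*-pos 0<t 0<s) (∥-nonzeroʳ flipped))))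
        where
        flipped : det base (rayᵇ j) ∥ det (rayᵇ j) (rayᵇ i)
        flipped = ∥-cong (trans (-‿cong (det-negate A B (rayᵇ j))) (-‿involutive (det base (rayᵇ j))))
                         (sym (det-swap (rayᵇ j) (rayᵇ i))) (∥-negate (increasingᵇ i<j))

      turnᵃ⁻ : ∀ {i j} → height j ∥ det (fromᵃ i) (fromᵃ j) → (π ⟨$⟩ˡ i) < (π ⟨$⟩ˡ j)
      turnᵃ⁻ {i} {j} p with Fin.<-cmp (π ⟨$⟩ˡ i) (π ⟨$⟩ˡ j)
      ... | tri< i<j _ _ = i<j
      ... | tri> _ _ j<i = contradiction (∥-cong refl (det-swap (fromᵃ i) (fromᵃ j)) p)
                             (∥-neg (∥-trans (heights-agree j i) (turnᵃ j<i)))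
      ... | tri≈ _ i≡j _ with injectiveˡ π i≡j
      ...   | ≡.refl = contradiction (det-self (fromᵃ i)) (∥-nonzeroʳ p)

      turnᵇ⁻ : ∀ {i j} → height j ∥ det (fromᵇ j) (fromᵇ i) → i < j
      turnᵇ⁻ {i} {j} p with Fin.<-cmp i j
      ... | tri< i<j _ _ = i<j
      ... | tri> _ _ j<i = contradiction (∥-cong refl (det-swap (fromᵇ j) (fromᵇ i)) p)
                             (∥-neg (∥-trans (heights-agree j i) (turnᵇ j<i)))
      ... | tri≈ _ ≡.refl _ = contradiction (det-self (fromᵇ i)) (∥-nonzeroʳ p)

      meetᵃ : ∀ {i j X} → InteriorOf A (pos (pt i)) X → InteriorOf A (pos (pt j)) X → i ≡ j
      meetᵃ {i} {j} X∈i X∈j with Fin.<-cmp (π ⟨$⟩ˡ i) (π ⟨$⟩ˡ j)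
      ... | tri< i<j _ _ = contradiction (turnᵃ i<j) (common-origin A (P i) (P j) X∈i X∈j)
      ... | tri> _ _ j<i = contradiction (turnᵃ j<i) (common-origin A (P j) (P i) X∈j X∈i)
      ... | tri≈ _ i≡j _ = injectiveˡ π i≡j

      meetᵇ : ∀ {i j X} → InteriorOf B (pos (pt i)) X → InteriorOf B (pos (pt j)) X → i ≡ j
      meetᵇ {i} {j} X∈i X∈j with Fin.<-cmp i j
      ... | tri< i<j _ _ = contradiction (turnᵇ i<j) (common-origin B (P j) (P i) X∈j X∈i)
      ... | tri> _ _ j<i = contradiction (turnᵇ j<i) (common-origin B (P i) (P j) X∈i X∈j)
      ... | tri≈ _ i≡j _ = i≡j

      meet⇒inversion : ∀ {i j X} → InteriorOf A (P i) X → InteriorOf B (P j) X → E π j i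
      meet⇒inversion {i} {j} X∈i X∈j = turnᵇ⁻ (crossing⇒turn A B (P i) (P j) X∈i X∈j (height≉0 i)) , turnᵃ⁻ turn
        where
        -- `crossing⇒turn` is used a second time with `A` and `B` exchanged. This negates the base,
        -- hence the height.
        height-from-b : - det (A -ᵖ B) (fromᵇ j) ≈ height j
        height-from-b = trans (-‿cong (trans (det-negate A B (fromᵇ j)) (-‿cong (det-baseᵇ A B (P j))))) (-‿involutive (height j))

        turn : height j ∥ det (fromᵃ i) (fromᵃ j)
        turn = ∥-cong height-from-b (sym (det-swap (fromᵃ i) (fromᵃ j)))
          (∥-negate (crossing⇒turn B A (P j) (P i) X∈j X∈i λ e →
            height≉0 j (trans (sym height-from-b) (trans (-‿cong e) -0#≈0#))))

      inversion⇒meet : ∀ {i j} → E π j i → ∃[ X ] InteriorOf A (P i) X × InteriorOf B (P j) X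
      inversion⇒meet {i} {j} (j<i , i<j) = turns⇒crossing A B (P i) (P j) (heights-agree i j) (turnᵇ j<i) (turnᵃ i<j)

  -- Crossings

  sameEdge-sym : ∀ {V : Set} {e f : V × V} → SameEdge e f → SameEdge f e
  sameEdge-sym (inj₁ (≡.refl , ≡.refl)) = inj₁ (≡.refl , ≡.refl)
  sameEdge-sym (inj₂ (≡.refl , ≡.refl)) = inj₂ (≡.refl , ≡.refl)

  sameEdge-trans : ∀ {V : Set} {e f g : V × V} → SameEdge e f → SameEdge f g → SameEdge e g
  sameEdge-trans (inj₁ (≡.refl , ≡.refl)) q                        = q
  sameEdge-trans (inj₂ (≡.refl , ≡.refl)) (inj₁ (≡.refl , ≡.refl)) = inj₂ (≡.refl , ≡.refl)
  sameEdge-trans (inj₂ (≡.refl , ≡.refl)) (inj₂ (≡.refl , ≡.refl)) = inj₁ (≡.refl , ≡.refl)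

  sameEdge-map : ∀ {V W : Set} (φ : V → W) {u v x y} → SameEdge (u , v) (x , y) → SameEdge (φ u , φ v) (φ x , φ y)
  sameEdge-map φ (inj₁ (≡.refl , ≡.refl)) = inj₁ (≡.refl , ≡.refl)
  sameEdge-map φ (inj₂ (≡.refl , ≡.refl)) = inj₂ (≡.refl , ≡.refl)

  data EdgeView {n} (e : Vertex n × Vertex n) : Set where
    edgeᵃ : ∀ i → SameEdge e (a , pt i) → EdgeView e
    edgeᵇ : ∀ i → SameEdge e (b , pt i) → EdgeView e

  edgeView : ∀ {n} {u v : Vertex n} → K₂-Adj u v → EdgeView (u , v)
  edgeView a-pt = edgeᵃ _ (inj₁ (≡.refl , ≡.refl))
  edgeView pt-a = edgeᵃ _ (inj₂ (≡.refl , ≡.refl))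
  edgeView b-pt = edgeᵇ _ (inj₁ (≡.refl , ≡.refl))
  edgeView pt-b = edgeᵇ _ (inj₂ (≡.refl , ≡.refl))

  isEdgeᵃ : ∀ {n} {u v : Vertex n} {i} → SameEdge (u , v) (a , pt i) → K₂-Adj u v
  isEdgeᵃ (inj₁ (≡.refl , ≡.refl)) = a-pt
  isEdgeᵃ (inj₂ (≡.refl , ≡.refl)) = pt-a

  isEdgeᵇ : ∀ {n} {u v : Vertex n} {i} → SameEdge (u , v) (b , pt i) → K₂-Adj u v
  isEdgeᵇ (inj₁ (≡.refl , ≡.refl)) = b-pt
  isEdgeᵇ (inj₂ (≡.refl , ≡.refl)) = pt-b

  edgeᵃ≢edgeᵇ : ∀ {n} {e f : Vertex n × Vertex n} {i j} →
                SameEdge e (a , pt i) → SameEdge f (b , pt j) → ¬ SameEdge e f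
  edgeᵃ≢edgeᵇ e∼a f∼b e∼f with sameEdge-trans (sameEdge-sym e∼a) (sameEdge-trans e∼f f∼b)
  ... | inj₁ (() , _)
  ... | inj₂ (() , _)

  -- `Cross` without coordinates. It depends only on `π`, so geo-isomorphisms can be obtained from
  -- maps that respect `E`.
  data Crosses {n} (π : Permutation′ n) (e f : Vertex n × Vertex n) : Set where
    crossᵃᵇ : ∀ {i j} → SameEdge e (a , pt i) → SameEdge f (b , pt j) → E π j i → Crosses π e f
    crossᵇᵃ : ∀ {i j} → SameEdge e (b , pt j) → SameEdge f (a , pt i) → E π j i → Crosses π e f

  crosses⇒E : ∀ {n} {π : Permutation′ n} {i j} → Crosses π (a , pt i) (b , pt j) → E π j i
  crosses⇒E (crossᵃᵇ (inj₁ (≡.refl , ≡.refl)) (inj₁ (≡.refl , ≡.refl)) e) = e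
  crosses⇒E (crossᵃᵇ (inj₂ (() , _)) _ _)
  crosses⇒E (crossᵃᵇ _ (inj₂ (() , _)) _)
  crosses⇒E (crossᵇᵃ (inj₁ (() , _)) _ _)
  crosses⇒E (crossᵇᵃ (inj₂ (() , _)) _ _)

  crosses-sym : ∀ {n} {π : Permutation′ n} {e f} → Crosses π e f → Crosses π f e
  crosses-sym (crossᵃᵇ p q e) = crossᵇᵃ q p e
  crosses-sym (crossᵇᵃ p q e) = crossᵃᵇ q p e

  module _ {n} {π : Permutation′ n} {pos : Vertex n → Point} (conf : RayConfiguration π pos) where
    open RayConfiguration conf

    Interior : Vertex n × Vertex n → Point → Set (c ⊔ ℓ₁ ⊔ ℓ₂)
    Interior (u , v) = InteriorOf (pos u) (pos v)

    interior-resp : ∀ e f X → SameEdge e f → Interior e X → Interior f X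
    interior-resp e f X (inj₁ (≡.refl , ≡.refl)) X∈e = X∈e
    interior-resp e@(u , v) f X (inj₂ (≡.refl , ≡.refl)) X∈e = interior-flip (pos u) (pos v) X X∈e

    crosses⇒meet : ∀ e f → Crosses π e f → ∃[ X ] Interior e X × Interior f X
    crosses⇒meet e f (crossᵃᵇ {i} {j} p q inv) with inversion⇒meet inv
    ... | X , X∈i , X∈j = X , interior-resp (a , pt i) e X (sameEdge-sym p) X∈i
                            , interior-resp (b , pt j) f X (sameEdge-sym q) X∈j
    crosses⇒meet e f (crossᵇᵃ {i} {j} p q inv) with inversion⇒meet inv
    ... | X , X∈i , X∈j = X , interior-resp (b , pt j) e X (sameEdge-sym p) X∈j
                            , interior-resp (a , pt i) f X (sameEdge-sym q) X∈i

    meet⇒crosses : ∀ e f X → EdgeView e → EdgeView f → ¬ SameEdge e f → Interior e X → Interior f X → Crosses π e f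
    meet⇒crosses e f X (edgeᵃ i p) (edgeᵇ j q) _ X∈e X∈f =
      crossᵃᵇ p q (meet⇒inversion (interior-resp e (a , pt i) X p X∈e) (interior-resp f (b , pt j) X q X∈f))
    meet⇒crosses e f X (edgeᵇ j p) (edgeᵃ i q) _ X∈e X∈f =
      crossᵇᵃ p q (meet⇒inversion (interior-resp f (a , pt i) X q X∈f) (interior-resp e (b , pt j) X p X∈e))
    meet⇒crosses e f X (edgeᵃ i p) (edgeᵃ j q) e≁f X∈e X∈f
      with ≡.refl ← meetᵃ (interior-resp e (a , pt i) X p X∈e) (interior-resp f (a , pt j) X q X∈f) =
      contradiction (sameEdge-trans p (sameEdge-sym q)) e≁f
    meet⇒crosses e f X (edgeᵇ i p) (edgeᵇ j q) e≁f X∈e X∈f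
      with ≡.refl ← meetᵇ (interior-resp e (b , pt i) X p X∈e) (interior-resp f (b , pt j) X q X∈f) =
      contradiction (sameEdge-trans p (sameEdge-sym q)) e≁f

    -- Two of three edges start at the same vertex a or b, and such edges do not meet again.
    no-concurrence : ∀ e f g X → EdgeView e → EdgeView f → EdgeView g →
                     ¬ SameEdge e f → ¬ SameEdge f g → ¬ SameEdge e g →
                     Interior e X → Interior f X → ¬ Interior g X
    no-concurrence e f g X ve vf vg e≁f f≁g e≁g X∈e X∈f X∈g
      with meet⇒crosses e f X ve vf e≁f X∈e X∈f | meet⇒crosses f g X vf vg f≁g X∈f X∈g | meet⇒crosses e g X ve vg e≁g X∈e X∈g
    ... | crossᵃᵇ _ f∼b _ | crossᵃᵇ f∼a _ _ | _               = contradiction (inj₁ (≡.refl , ≡.refl)) (edgeᵃ≢edgeᵇ f∼a f∼b)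
    ... | crossᵇᵃ _ f∼a _ | crossᵇᵃ f∼b _ _ | _               = contradiction (inj₁ (≡.refl , ≡.refl)) (edgeᵃ≢edgeᵇ f∼a f∼b)
    ... | crossᵃᵇ e∼a _ _ | crossᵇᵃ _ _ _   | crossᵇᵃ e∼b _ _ = contradiction (inj₁ (≡.refl , ≡.refl)) (edgeᵃ≢edgeᵇ e∼a e∼b)
    ... | crossᵃᵇ _ _ _   | crossᵇᵃ _ g∼a _ | crossᵃᵇ _ g∼b _ = contradiction (inj₁ (≡.refl , ≡.refl)) (edgeᵃ≢edgeᵇ g∼a g∼b)
    ... | crossᵇᵃ e∼b _ _ | crossᵃᵇ _ _ _   | crossᵃᵇ e∼a _ _ = contradiction (inj₁ (≡.refl , ≡.refl)) (edgeᵃ≢edgeᵇ e∼a e∼b)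
    ... | crossᵇᵃ _ _ _   | crossᵃᵇ _ g∼b _ | crossᵇᵃ _ g∼a _ = contradiction (inj₁ (≡.refl , ≡.refl)) (edgeᵃ≢edgeᵇ g∼a g∼b)

  module _ {n} {π : Permutation′ n} (R : Realization π) where
    open Realization R

    rayConfiguration : RayConfiguration π pos
    rayConfiguration = record
      { rayᵃ = rayᵃ ; rayᵇ = rayᵇ ; same-side = same-side
      ; increasingᵃ = increasingᵃ ; increasingᵇ = increasingᵇ
      ; placedᵃ = placedᵃ ; placedᵇ = placedᵇ }

    cross⇒crosses : ∀ e f → Cross e f → Crosses π e f
    cross⇒crosses e f (ve , vf , e≁f , X , X∈e , X∈f) =
      meet⇒crosses rayConfiguration e f X (edgeView ve) (edgeView vf) e≁f X∈e X∈f

    crosses⇒cross : ∀ e f → Crosses π e f → Cross e f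
    crosses⇒cross e f x@(crossᵃᵇ p q _) = isEdgeᵃ p , isEdgeᵇ q , edgeᵃ≢edgeᵇ p q , crosses⇒meet rayConfiguration e f x
    crosses⇒cross e f x@(crossᵇᵃ p q _) = isEdgeᵇ p , isEdgeᵃ q , edgeᵃ≢edgeᵇ q p ∘ sameEdge-sym , crosses⇒meet rayConfiguration e f x

-- Automorphisms of K₂,ₙ and geo-isomorphisms

pt-injective : ∀ {n} {i j : Fin n} → pt i ≡ pt j → i ≡ j
pt-injective ≡.refl = ≡.refl

ab-neighbour : ∀ {n} {x y : Vertex n} → x ≡ a ⊎ x ≡ b → K₂-Adj x y → ∃[ i ] y ≡ pt i
ab-neighbour _ a-pt = _ , ≡.refl
ab-neighbour _ b-pt = _ , ≡.refl
ab-neighbour (inj₁ ()) pt-a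
ab-neighbour (inj₂ ()) pt-a
ab-neighbour (inj₁ ()) pt-b
ab-neighbour (inj₂ ()) pt-b

pt-neighbour : ∀ {n} {i} {y : Vertex n} → K₂-Adj (pt i) y → y ≡ a ⊎ y ≡ b
pt-neighbour pt-a = inj₁ ≡.refl
pt-neighbour pt-b = inj₂ ≡.refl

ab-adj-pt : ∀ {n} {x : Vertex n} {i} → x ≡ a ⊎ x ≡ b → K₂-Adj x (pt i)
ab-adj-pt (inj₁ ≡.refl) = a-pt
ab-adj-pt (inj₂ ≡.refl) = b-pt

module _ {n} (3≤n : 3 ℕ.≤ n) where

  -- A vertex x adjacent to all points cannot be mapped to a point, whose only neighbours are a and b.
  ab-preserved : (φ : Vertex n → Vertex n) → (∀ {x y} → φ x ≡ φ y → x ≡ y) →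
                 (∀ {x y} → K₂-Adj x y → K₂-Adj (φ x) (φ y)) →
                 ∀ {x} → x ≡ a ⊎ x ≡ b → φ x ≡ a ⊎ φ x ≡ b
  ab-preserved φ φ-inj φ-adj {x} x∈ab with φ x in eq
  ... | a    = inj₁ ≡.refl
  ... | b    = inj₂ ≡.refl
  ... | pt k = contradiction (Fin.pigeonhole 3≤n (side ∘ image))
    λ (i , j , i<j , same) → Fin.<⇒≢ i<j (pt-injective (φ-inj (side-injective (image i) (image j) same)))
    where
    image : ∀ i → φ (pt i) ≡ a ⊎ φ (pt i) ≡ b
    image i = pt-neighbour (≡.subst (λ v → K₂-Adj v (φ (pt i))) eq (φ-adj (ab-adj-pt x∈ab)))

    side : ∀ {y : Vertex n} → y ≡ a ⊎ y ≡ b → Fin 2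
    side (inj₁ _) = 0F
    side (inj₂ _) = 1F

    side-injective : ∀ {y z : Vertex n} (p : y ≡ a ⊎ y ≡ b) (q : z ≡ a ⊎ z ≡ b) → side p ≡ side q → y ≡ z
    side-injective (inj₁ ≡.refl) (inj₁ ≡.refl) _ = ≡.refl
    side-injective (inj₂ ≡.refl) (inj₂ ≡.refl) _ = ≡.refl
    side-injective (inj₁ _) (inj₂ _) ()
    side-injective (inj₂ _) (inj₁ _) ()

  record Automorphism (β : Vertex n ↔ Vertex n) : Set where
    open Inverse β using () renaming (to to φ)
    field
      points    : Permutation′ n
      on-points : ∀ i → φ (pt i) ≡ pt (points ⟨$⟩ʳ i)
      on-ab     : (φ a ≡ a × φ b ≡ b) ⊎ (φ a ≡ b × φ b ≡ a)

  -- Since `φ a` is again `a` or `b`, its neighbours are points, so the images of points are points.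
  -- The same argument for the inverse provides the inverse permutation.
  automorphism : (β : Vertex n ↔ Vertex n) → let open Inverse β using () renaming (to to φ) in
                 (∀ u v → K₂-Adj u v ⇔ K₂-Adj (φ u) (φ v)) → Automorphism β
  automorphism β φ-adj = record
    { points    = permutation f g
        (λ i → pt-injective (≡.trans (≡.sym (φ-pt _)) (≡.trans (≡.cong φ (≡.sym (ψ-pt i))) (φψ (pt i)))))
        (λ i → pt-injective (≡.trans (≡.sym (ψ-pt _)) (≡.trans (≡.cong ψ (≡.sym (φ-pt i))) (ψφ (pt i)))))
    ; on-points = φ-pt
    ; on-ab     = on-ab (preserved (inj₁ ≡.refl)) (preserved (inj₂ ≡.refl))
    }
    where
    open Inverse β using (strictlyInverseˡ; strictlyInverseʳ) renaming (to to φ; from to ψ)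

    φψ : ∀ x → φ (ψ x) ≡ x
    φψ = strictlyInverseˡ

    ψφ : ∀ x → ψ (φ x) ≡ x
    ψφ = strictlyInverseʳ

    φ-inj : ∀ {x y} → φ x ≡ φ y → x ≡ y
    φ-inj {x} {y} e = ≡.trans (≡.sym (ψφ x)) (≡.trans (≡.cong ψ e) (ψφ y))

    ψ-inj : ∀ {x y} → ψ x ≡ ψ y → x ≡ y
    ψ-inj {x} {y} e = ≡.trans (≡.sym (φψ x)) (≡.trans (≡.cong φ e) (φψ y))

    ψ-adj : ∀ {x y} → K₂-Adj x y → K₂-Adj (ψ x) (ψ y)
    ψ-adj {x} {y} e = from (φ-adj _ _) (≡.subst₂ K₂-Adj (≡.sym (φψ x)) (≡.sym (φψ y)) e)

    preserved : ∀ {x} → x ≡ a ⊎ x ≡ b → φ x ≡ a ⊎ φ x ≡ b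
    preserved = ab-preserved φ φ-inj (to (φ-adj _ _))

    f g : Fin n → Fin n
    f i = proj₁ (ab-neighbour (preserved (inj₁ ≡.refl)) (to (φ-adj _ _) (a-pt {i = i})))
    g i = proj₁ (ab-neighbour (ab-preserved ψ ψ-inj ψ-adj (inj₁ ≡.refl)) (ψ-adj (a-pt {i = i})))

    φ-pt : ∀ i → φ (pt i) ≡ pt (f i)
    φ-pt i = proj₂ (ab-neighbour (preserved (inj₁ ≡.refl)) (to (φ-adj _ _) (a-pt {i = i})))

    ψ-pt : ∀ i → ψ (pt i) ≡ pt (g i)
    ψ-pt i = proj₂ (ab-neighbour (ab-preserved ψ ψ-inj ψ-adj (inj₁ ≡.refl)) (ψ-adj (a-pt {i = i})))

    a≢b : ¬ _≡_ {A = Vertex n} a b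
    a≢b ()

    on-ab : φ a ≡ a ⊎ φ a ≡ b → φ b ≡ a ⊎ φ b ≡ b → (φ a ≡ a × φ b ≡ b) ⊎ (φ a ≡ b × φ b ≡ a)
    on-ab (inj₁ p) (inj₁ q) = contradiction (φ-inj (≡.trans p (≡.sym q))) a≢b
    on-ab (inj₁ p) (inj₂ q) = inj₁ (p , q)
    on-ab (inj₂ p) (inj₁ q) = inj₂ (p , q)
    on-ab (inj₂ p) (inj₂ q) = contradiction (φ-inj (≡.trans p (≡.sym q))) a≢b

-- Geo-equivalence as isomorphism of inversion digraphs up to reversal

module GeoEquivalence {c ℓ₁ ℓ₂} (𝔽 : OrderedField c ℓ₁ ℓ₂) where
  open Geometry 𝔽
  open GeometryProperties 𝔽

  module _ {n} (3≤n : 3 ℕ.≤ n) {σ π : Permutation′ n} where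

    -- The arc from `j` to `i` is the crossing of the edges `a i` and `b j`. If `a` and `b` are
    -- exchanged, the image of `i` is met from `b` and that of `j` from `a`, which is the reversed
    -- arc.
    ∼⇒≅± : σ ∼ π → σ ≅± π
    ∼⇒≅± (R , S , iso) = classify on-ab
      where
      module R = Realization R
      module S = Realization S
      open GeoIso iso
      open Inverse bijection using () renaming (to to φ)
      open Automorphism (automorphism 3≤n bijection adjacency)

      R-cross : ∀ {i j} → R.Cross (a , pt i) (b , pt j) ⇔ E σ j i
      R-cross = mk⇔ (crosses⇒E ∘ cross⇒crosses R _ _)
        (crosses⇒cross R _ _ ∘ crossᵃᵇ (inj₁ (≡.refl , ≡.refl)) (inj₁ (≡.refl , ≡.refl)))

      S-cross : ∀ {i j} → S.Cross (a , pt i) (b , pt j) ⇔ E π j i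
      S-cross = mk⇔ (crosses⇒E ∘ cross⇒crosses S _ _)
        (crosses⇒cross S _ _ ∘ crossᵃᵇ (inj₁ (≡.refl , ≡.refl)) (inj₁ (≡.refl , ≡.refl)))

      S-cross′ : ∀ {i j} → S.Cross (b , pt j) (a , pt i) ⇔ E π j i
      S-cross′ = mk⇔ (crosses⇒E ∘ crosses-sym ∘ cross⇒crosses S _ _)
        (crosses⇒cross S _ _ ∘ crossᵇᵃ (inj₁ (≡.refl , ≡.refl)) (inj₁ (≡.refl , ≡.refl)))

      φ-cross : ∀ {x y i j} → φ a ≡ x → φ b ≡ y →
                R.Cross (a , pt i) (b , pt j) ⇔ S.Cross (x , pt (points ⟨$⟩ʳ i)) (y , pt (points ⟨$⟩ʳ j))
      φ-cross {i = i} {j} ≡.refl ≡.refl = ≡.subst₂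
        (λ v w → R.Cross (a , pt i) (b , pt j) ⇔ S.Cross (φ a , v) (φ b , w)) (on-points i) (on-points j)
        (crossing a (pt i) b (pt j))

      classify : (φ a ≡ a × φ b ≡ b) ⊎ (φ a ≡ b × φ b ≡ a) → σ ≅± π
      classify (inj₁ (p , q)) = inj₁ (points , λ u v → mk⇔
        (to S-cross ∘ to (φ-cross p q) ∘ from R-cross) (to R-cross ∘ from (φ-cross p q) ∘ from S-cross))
      classify (inj₂ (p , q)) = inj₂ (points , λ u v → mk⇔
        (to S-cross′ ∘ to (φ-cross p q) ∘ from R-cross) (to R-cross ∘ from (φ-cross p q) ∘ from S-cross′))

  keep swap-ab : ∀ {n} → (Fin n → Fin n) → Vertex n → Vertex n
  keep f a      = a
  keep f b      = b
  keep f (pt i) = pt (f i)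
  swap-ab f a      = b
  swap-ab f b      = a
  swap-ab f (pt i) = pt (f i)

  keep-crosses : ∀ {n} {σ π : Permutation′ n} (f : Fin n → Fin n) → (∀ {u v} → E σ u v → E π (f u) (f v)) →
                 ∀ {u v w x} → let φ = keep f in Crosses σ (u , v) (w , x) → Crosses π (φ u , φ v) (φ w , φ x)
  keep-crosses f f-E (crossᵃᵇ p q e) = crossᵃᵇ (sameEdge-map (keep f) p) (sameEdge-map (keep f) q) (f-E e)
  keep-crosses f f-E (crossᵇᵃ p q e) = crossᵇᵃ (sameEdge-map (keep f) p) (sameEdge-map (keep f) q) (f-E e)

  swap-crosses : ∀ {n} {σ π : Permutation′ n} (f : Fin n → Fin n) → (∀ {u v} → E σ u v → E π (f v) (f u)) →
                 ∀ {u v w x} → let φ = swap-ab f in Crosses σ (u , v) (w , x) → Crosses π (φ u , φ v) (φ w , φ x)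
  swap-crosses f f-E (crossᵃᵇ p q e) = crossᵇᵃ (sameEdge-map (swap-ab f) p) (sameEdge-map (swap-ab f) q) (f-E e)
  swap-crosses f f-E (crossᵇᵃ p q e) = crossᵃᵇ (sameEdge-map (swap-ab f) p) (sameEdge-map (swap-ab f) q) (f-E e)

  keep-adj : ∀ {n} (f : Fin n → Fin n) {u v} → K₂-Adj u v → K₂-Adj (keep f u) (keep f v)
  keep-adj f a-pt = a-pt
  keep-adj f pt-a = pt-a
  keep-adj f b-pt = b-pt
  keep-adj f pt-b = pt-b

  swap-adj : ∀ {n} (f : Fin n → Fin n) {u v} → K₂-Adj u v → K₂-Adj (swap-ab f u) (swap-ab f v)
  swap-adj f a-pt = b-pt
  swap-adj f pt-a = pt-b
  swap-adj f b-pt = a-pt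
  swap-adj f pt-b = pt-a

  module _ {n} {σ π : Permutation′ n} (R : Realization σ) (S : Realization π) where

    geoIso : (φ ψ : Vertex n → Vertex n) → (∀ x → φ (ψ x) ≡ x) → (∀ x → ψ (φ x) ≡ x) →
             (∀ {u v} → K₂-Adj u v → K₂-Adj (φ u) (φ v)) → (∀ {u v} → K₂-Adj u v → K₂-Adj (ψ u) (ψ v)) →
             (∀ {u v w x} → Crosses σ (u , v) (w , x) → Crosses π (φ u , φ v) (φ w , φ x)) →
             (∀ {u v w x} → Crosses π (u , v) (w , x) → Crosses σ (ψ u , ψ v) (ψ w , ψ x)) →
             GeoIso (Realization.geometricGraph R) (Realization.geometricGraph S)
    geoIso φ ψ φψ ψφ φ-adj ψ-adj φ-crosses ψ-crosses = record
      { bijection = mk↔ₛ′ φ ψ φψ ψφ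
      ; adjacency = λ u v → mk⇔ φ-adj (≡.subst₂ K₂-Adj (ψφ u) (ψφ v) ∘ ψ-adj)
      ; crossing  = λ u v w x → mk⇔
          (crosses⇒cross S _ _ ∘ φ-crosses ∘ cross⇒crosses R _ _)
          (crosses⇒cross R _ _ ∘ ≡.subst₂ (Crosses σ) (≡.cong₂ _,_ (ψφ u) (ψφ v)) (≡.cong₂ _,_ (ψφ w) (ψφ x))
            ∘ ψ-crosses ∘ cross⇒crosses S _ _)
      }

    -- Any two realizations serve, as the crossings in each are determined by its permutation. An
    -- isomorphism onto the reversed digraph is extended by exchanging `a` and `b`.
    ≅±⇒geoIso : σ ≅± π → GeoIso (Realization.geometricGraph R) (Realization.geometricGraph S)
    ≅±⇒geoIso (inj₁ iso@(f , σ⇔π)) = geoIso (keep (f ⟨$⟩ʳ_)) (keep (f ⟨$⟩ˡ_))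
      (λ { a → ≡.refl ; b → ≡.refl ; (pt i) → ≡.cong pt (inverseʳ f) })
      (λ { a → ≡.refl ; b → ≡.refl ; (pt i) → ≡.cong pt (inverseˡ f) })
      (keep-adj (f ⟨$⟩ʳ_)) (keep-adj (f ⟨$⟩ˡ_))
      (keep-crosses (f ⟨$⟩ʳ_) (to (σ⇔π _ _)))
      (keep-crosses (f ⟨$⟩ˡ_) (to (proj₂ (≅ᵈ-sym (D σ) (D π) iso) _ _)))
    ≅±⇒geoIso (inj₂ iso@(f , σ⇔π)) = geoIso (swap-ab (f ⟨$⟩ʳ_)) (swap-ab (f ⟨$⟩ˡ_))
      (λ { a → ≡.refl ; b → ≡.refl ; (pt i) → ≡.cong pt (inverseʳ f) })
      (λ { a → ≡.refl ; b → ≡.refl ; (pt i) → ≡.cong pt (inverseˡ f) })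
      (swap-adj (f ⟨$⟩ʳ_)) (swap-adj (f ⟨$⟩ˡ_))
      (swap-crosses (f ⟨$⟩ʳ_) (to (σ⇔π _ _)))
      (swap-crosses (f ⟨$⟩ˡ_) (to (proj₂ (≅ᵈ-sym (D σ) (D π ᵒ) iso) _ _)))

-- Generic coordinates

module Coordinates (n : ℕ) where

  -- `U` takes values from 1 to `n`. The base `2n + 1` makes each value of `V` exceed `2n` times
  -- every later one, hence any sum of two later values with coefficients up to `n`.
  U V : Fin n → ℕ
  U i = n ℕ.∸ Fin.toℕ i
  V i = ℕ.suc (n ℕ.+ n) ℕ.^ (n ℕ.∸ Fin.toℕ i)

  U>0 : ∀ i → 0 ℕ.< U i
  U>0 i = ℕ.m<n⇒0<n∸m (Fin.toℕ<n i)

  V>0 : ∀ i → 0 ℕ.< V i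
  V>0 i = ℕ.m^n>0 (ℕ.suc (n ℕ.+ n)) (n ℕ.∸ Fin.toℕ i)

  U≤n : ∀ i → U i ℕ.≤ n
  U≤n i = ℕ.m∸n≤m n (Fin.toℕ i)

  U-anti : ∀ {i j} → i < j → U j ℕ.< U i
  U-anti {i} {j} i<j = ℕ.∸-monoʳ-< i<j (Fin.toℕ≤n j)

  U-injective : ∀ {i j} → U i ≡ U j → i ≡ j
  U-injective {i} {j} eq with Fin.<-cmp i j
  ... | tri< i<j _ _ = contradiction (≡.sym eq) (ℕ.<⇒≢ (U-anti i<j))
  ... | tri≈ _ i≡j _ = i≡j
  ... | tri> _ _ j<i = contradiction eq (ℕ.<⇒≢ (U-anti j<i))

  V-dominates : ∀ {i j} → i < j → (n ℕ.+ n) ℕ.* V j ℕ.< V i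
  V-dominates {i} {j} i<j = begin-strict
    (n ℕ.+ n) ℕ.* V j                          <⟨ ℕ.m<n+m _ (V>0 j) ⟩
    ℕ.suc (n ℕ.+ n) ℕ.^ ℕ.suc (n ℕ.∸ Fin.toℕ j)  ≤⟨ ℕ.^-monoʳ-≤ (ℕ.suc (n ℕ.+ n)) (U-anti i<j) ⟩
    V i                                        ∎
    where open ℕ.≤-Reasoning

  V-anti : ∀ {i j} → i < j → V j ℕ.< V i
  V-anti {i} {j} i<j = begin-strict
    V j                ≤⟨ ℕ.m≤n*m (V j) (n ℕ.+ n) {{ℕ.>-nonZero (ℕ.≤-trans n>0 (ℕ.m≤m+n n n))}} ⟩
    (n ℕ.+ n) ℕ.* V j  <⟨ V-dominates i<j ⟩
    V i                ∎
    where
    open ℕ.≤-Reasoning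
    n>0 : 0 ℕ.< n
    n>0 = ℕ.≤-trans (s≤s z≤n) (Fin.toℕ<n i)

  private
    dominated : ∀ {i j k x y} → i < j → j < k → x ℕ.≤ n → y ℕ.≤ n → x ℕ.* V k ℕ.+ y ℕ.* V j ℕ.< V i
    dominated {i} {j} {k} {x} {y} i<j j<k x≤n y≤n = begin-strict
      x ℕ.* V k ℕ.+ y ℕ.* V j  ≤⟨ ℕ.+-mono-≤ (ℕ.*-mono-≤ x≤n (ℕ.<⇒≤ (V-anti j<k))) (ℕ.*-monoˡ-≤ (V j) y≤n) ⟩
      n ℕ.* V j ℕ.+ n ℕ.* V j  ≡⟨ ℕ.*-distribʳ-+ (V j) n n ⟨
      (n ℕ.+ n) ℕ.* V j        <⟨ V-dominates i<j ⟩
      V i                      ∎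
      where open ℕ.≤-Reasoning

    -- As in positional notation: a remainder below `v` cannot make up for a smaller leading
    -- coefficient.
    carry : ∀ {x y r v} s → x ℕ.< y → r ℕ.< v → x ℕ.* v ℕ.+ r ℕ.< y ℕ.* v ℕ.+ s
    carry {x} {y} {r} {v} s x<y r<v = begin-strict
      x ℕ.* v ℕ.+ r   <⟨ ℕ.+-monoʳ-< (x ℕ.* v) r<v ⟩
      x ℕ.* v ℕ.+ v   ≡⟨ ℕ.+-comm (x ℕ.* v) v ⟩
      ℕ.suc x ℕ.* v   ≤⟨ ℕ.*-monoˡ-≤ v x<y ⟩
      y ℕ.* v         ≤⟨ ℕ.m≤m+n (y ℕ.* v) s ⟩
      y ℕ.* v ℕ.+ s   ∎
      where open ℕ.≤-Reasoning

  -- The equation says that (x , V i), (y , V j) and (z , V k) are collinear. Since V i exceeds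
  -- everything else, its coefficients y and z would have to agree.
  generic : ∀ {i j k x y z} → i < j → j < k → x ℕ.≤ n → y ℕ.≤ n → z ℕ.≤ n → y ≢ z →
            y ℕ.* V i ℕ.+ (x ℕ.* V k ℕ.+ z ℕ.* V j) ≢ z ℕ.* V i ℕ.+ (y ℕ.* V k ℕ.+ x ℕ.* V j)
  generic {y = y} {z} i<j j<k x≤n y≤n z≤n′ y≢z eq with ℕ.<-cmp y z
  ... | tri< y<z _ _ = ℕ.<⇒≢ (carry _ y<z (dominated i<j j<k x≤n z≤n′)) eq
  ... | tri≈ _ y≡z _ = y≢z y≡z
  ... | tri> _ _ z<y = ℕ.<⇒≢ (carry _ z<y (dominated i<j j<k y≤n x≤n)) (≡.sym eq)

-- Existence of realizations

module Construction {c ℓ₁ ℓ₂} (𝔽 : OrderedField c ℓ₁ ℓ₂) {n} (π : Permutation′ n) where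
  open OrderedField 𝔽
  open OrderedFieldProperties 𝔽
  open Geometry 𝔽
  open GeometryProperties 𝔽
  open Coordinates n

  u v : Fin n → Carrier
  u i = U i ⊠ 1#
  v i = V i ⊠ 1#

  abstract
    reciprocal : ∀ i j → ∃[ κ ] 0# <ᶠ κ × (u i + v j) * κ ≈ 1#
    reciprocal i j = κ , *-pos⁻ w>0 (<-respʳ (sym wκ≈1) 0<1) , wκ≈1
      where
      w>0 : 0# <ᶠ u i + v j
      w>0 = +-pos (⊠-mono (U>0 i)) (⊠-mono (V>0 j))
      w≉0 : ¬ u i + v j ≈ 0#
      w≉0 w≈0 = 0≮0 w≈0 w>0
      κ : Carrier
      κ = proj₁ (inverse (u i + v j) w≉0)
      wκ≈1 : (u i + v j) * κ ≈ 1#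
      wκ≈1 = proj₂ (inverse (u i + v j) w≉0)

  κ : Fin n → Fin n → Carrier
  κ i j = proj₁ (reciprocal i j)

  -- The intersection of the lines x = u y and x = 1 - v y.
  crossroad : Fin n → Fin n → Point
  crossroad i j = u i * κ i j , κ i j

  pos : Vertex n → Point
  pos a      = 0# , 0#
  pos b      = 1# , 0#
  pos (pt i) = crossroad (π ⟨$⟩ˡ i) i

  -- With second coordinate 1 all rays point to the same side of the line `ab`, and the determinant
  -- of two rays from one origin is a difference of values of `u` or of `v`.
  rayᵃ rayᵇ : Fin n → Point
  rayᵃ i = u i , 1#
  rayᵇ j = - v j , 1#

  abstract
    onRayᵃ : ∀ i j → OnRay (pos a) (rayᵃ i) (crossroad i j)
    onRayᵃ i j = κ i j , proj₁ (proj₂ (reciprocal i j))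
      , solve 2 (λ u κ → u :* κ := :0 :+ κ :* u) refl (u i) (κ i j)
      , solve 1 (λ κ → κ := :0 :+ κ :* :1) refl (κ i j)

    onRayᵇ : ∀ i j → OnRay (pos b) (rayᵇ j) (crossroad i j)
    onRayᵇ i j = κ i j , proj₁ (proj₂ (reciprocal i j))
      , trans (solve 3 (λ u v κ → u :* κ := (u :+ v) :* κ :+ κ :* (:- v)) refl (u i) (v j) (κ i j))
              (+-congʳ (proj₂ (proj₂ (reciprocal i j))))
      , solve 1 (λ κ → κ := :0 :+ κ :* :1) refl (κ i j)

  configuration : RayConfiguration π pos
  configuration = record
    { rayᵃ        = rayᵃ
    ; rayᵇ        = rayᵇ
    ; same-side   = same-side
    ; increasingᵃ = increasingᵃ
    ; increasingᵇ = increasingᵇ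
    ; placedᵃ     = placedᵃ
    ; placedᵇ     = λ k → onRayᵇ (π ⟨$⟩ˡ k) k
    }
    where
    abstract
      same-side : ∀ i j → SameSide (pos b -ᵖ pos a) (rayᵃ i) (rayᵇ j)
      same-side i j = <-respʳ (solve 2 (λ u v →
        let w = (:1 , :0) :-ᵖ (:0 , :0) in :1 := :det w (u , :1) :* :det w (:- v , :1)) refl (u i) (v j)) 0<1

      increasingᵃ : ∀ {i j} → i < j → SmallerAngle (pos b -ᵖ pos a) (rayᵃ i) (rayᵃ j)
      increasingᵃ {i} {j} i<j = <-respʳ (solve 2 (λ u u′ →
        u :- u′ := :det ((:1 , :0) :-ᵖ (:0 , :0)) (u′ , :1) :* :det (u , :1) (u′ , :1)) refl (u i) (u j))
        (<⇒0<- (⊠-mono (U-anti i<j)))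

      increasingᵇ : ∀ {i j} → i < j → SmallerAngle (pos a -ᵖ pos b) (rayᵇ i) (rayᵇ j)
      increasingᵇ {i} {j} i<j = <-respʳ (solve 2 (λ v v′ →
        v :- v′ := :det ((:0 , :0) :-ᵖ (:1 , :0)) (:- v′ , :1) :* :det (:- v , :1) (:- v′ , :1)) refl (v i) (v j))
        (<⇒0<- (⊠-mono (V-anti i<j)))

      placedᵃ : ∀ k → OnRay (pos a) (rayᵃ k) (pos (pt (π ⟨$⟩ʳ k)))
      placedᵃ k = ≡.subst (λ i → OnRay (pos a) (rayᵃ k) (crossroad i (π ⟨$⟩ʳ k))) (≡.sym (inverseˡ π)) (onRayᵃ k (π ⟨$⟩ʳ k))

  open RayConfiguration configuration using (A; B; P; fromᵃ; fromᵇ; base; height; height≉0; turnᵃ; turnᵇ)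

  abstract
    collinear-swapˡ : ∀ p q r → Collinear p q r → Collinear q p r
    collinear-swapˡ (p₁ , p₂) (q₁ , q₂) (r₁ , r₂) e = trans (solve 6 (λ p₁ p₂ q₁ q₂ r₁ r₂ →
      let p = p₁ , p₂ ; q = q₁ , q₂ ; r = r₁ , r₂ in
      :det (p :-ᵖ q) (r :-ᵖ q) := :- :det (q :-ᵖ p) (r :-ᵖ p)) refl p₁ p₂ q₁ q₂ r₁ r₂)
      (trans (-‿cong e) (solve 0 (:- :0 := :0) refl))

    collinear-swapʳ : ∀ p q r → Collinear p q r → Collinear p r q
    collinear-swapʳ p q r e = trans (det-swap (r -ᵖ p) (q -ᵖ p)) (trans (-‿cong e) (solve 0 (:- :0 := :0) refl))

    ab-noncollinear : ∀ i → ¬ Collinear A B (P i)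
    ab-noncollinear i = height≉0 i

    a-noncollinear : ∀ {i j} → i ≢ j → ¬ Collinear A (P i) (P j)
    a-noncollinear {i} {j} i≢j e with Fin.<-cmp (π ⟨$⟩ˡ i) (π ⟨$⟩ˡ j)
    ... | tri< i<j _ _ = ∥-nonzeroʳ (turnᵃ i<j) e
    ... | tri≈ _ i≡j _ = i≢j (injectiveˡ π i≡j)
    ... | tri> _ _ j<i = ∥-nonzeroʳ (turnᵃ j<i) (collinear-swapʳ A (P i) (P j) e)

    b-noncollinear : ∀ {i j} → i ≢ j → ¬ Collinear B (P i) (P j)
    b-noncollinear {i} {j} i≢j e with Fin.<-cmp i j
    ... | tri< i<j _ _ = ∥-nonzeroʳ (turnᵇ i<j) (collinear-swapʳ B (P i) (P j) e)
    ... | tri≈ _ i≡j _ = i≢j i≡j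
    ... | tri> _ _ j<i = ∥-nonzeroʳ (turnᵇ j<i) e

    -- The projective map (x , y) ↦ (x / y , (1 - x) / y) sends the points to (u , v).
    collinear⇒balanced : ∀ {u₁ u₂ u₃ v₁ v₂ v₃ κ₁ κ₂ κ₃} →
      (u₁ + v₁) * κ₁ ≈ 1# → (u₂ + v₂) * κ₂ ≈ 1# → (u₃ + v₃) * κ₃ ≈ 1# →
      Collinear (u₁ * κ₁ , κ₁) (u₂ * κ₂ , κ₂) (u₃ * κ₃ , κ₃) →
      u₂ * v₁ + (u₁ * v₃ + u₃ * v₂) ≈ u₃ * v₁ + (u₂ * v₃ + u₁ * v₂)
    collinear⇒balanced {u₁} {u₂} {u₃} {v₁} {v₂} {v₃} {κ₁} {κ₂} {κ₃} e₁ e₂ e₃ collinear = begin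
      u₂ * v₁ + (u₁ * v₃ + u₃ * v₂)
        ≈⟨ solve 6 (λ u₁ u₂ u₃ v₁ v₂ v₃ →
             u₂ :* v₁ :+ (u₁ :* v₃ :+ u₃ :* v₂) :=
             (((u₁ :- u₂) :* (u₃ :+ v₃) :* (:1 :* :1) :+ (u₂ :- u₃) :* (u₁ :+ v₁) :* (:1 :* :1))
               :+ (u₃ :- u₁) :* (u₂ :+ v₂) :* (:1 :* :1))
             :+ (u₃ :* v₁ :+ (u₂ :* v₃ :+ u₁ :* v₂))) refl u₁ u₂ u₃ v₁ v₂ v₃ ⟩
      -- Each factor `1# * 1#` is a placeholder for two of the products `w κ`. Once they are filled
      -- in, the bracket becomes `w₁ * w₂ * w₃` times the determinant that expresses collinearity.
      (((u₁ - u₂) * w₃ * (1# * 1#) + (u₂ - u₃) * w₁ * (1# * 1#)) + (u₃ - u₁) * w₂ * (1# * 1#)) + rhs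
        ≈⟨ +-congʳ (+-cong (+-cong (*-congˡ (*-cong e₁ e₂)) (*-congˡ (*-cong e₂ e₃))) (*-congˡ (*-cong e₃ e₁))) ⟨
      (((u₁ - u₂) * w₃ * (w₁ * κ₁ * (w₂ * κ₂)) + (u₂ - u₃) * w₁ * (w₂ * κ₂ * (w₃ * κ₃)))
        + (u₃ - u₁) * w₂ * (w₃ * κ₃ * (w₁ * κ₁))) + rhs
        ≈⟨ +-congʳ (solve 9 (λ u₁ u₂ u₃ w₁ w₂ w₃ κ₁ κ₂ κ₃ →
             let p = u₁ :* κ₁ , κ₁ ; q = u₂ :* κ₂ , κ₂ ; r = u₃ :* κ₃ , κ₃ in
             ((u₁ :- u₂) :* w₃ :* (w₁ :* κ₁ :* (w₂ :* κ₂)) :+ (u₂ :- u₃) :* w₁ :* (w₂ :* κ₂ :* (w₃ :* κ₃)))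
               :+ (u₃ :- u₁) :* w₂ :* (w₃ :* κ₃ :* (w₁ :* κ₁)) :=
             w₁ :* w₂ :* w₃ :* :det (q :-ᵖ p) (r :-ᵖ p)) refl u₁ u₂ u₃ w₁ w₂ w₃ κ₁ κ₂ κ₃) ⟩
      w₁ * w₂ * w₃ * det ((u₂ * κ₂ , κ₂) -ᵖ (u₁ * κ₁ , κ₁)) ((u₃ * κ₃ , κ₃) -ᵖ (u₁ * κ₁ , κ₁)) + rhs
        ≈⟨ +-congʳ (trans (*-congˡ collinear) (zeroʳ _)) ⟩
      0# + rhs
        ≈⟨ +-identityˡ rhs ⟩
      rhs ∎
      where
      open SetoidReasoning setoid
      w₁ w₂ w₃ rhs : Carrier
      w₁ = u₁ + v₁
      w₂ = u₂ + v₂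
      w₃ = u₃ + v₃
      rhs = u₃ * v₁ + (u₂ * v₃ + u₁ * v₂)

    -- Collinearity becomes an equation between images of natural numbers. The embedding of the
    -- naturals in an ordered field is injective, so the equation holds in the naturals, against
    -- `generic`.
    sorted-noncollinear : ∀ {i j k} → i < j → j < k → ¬ Collinear (P i) (P j) (P k)
    sorted-noncollinear {i} {j} {k} i<j j<k collinear =
      generic i<j j<k (U≤n i′) (U≤n j′) (U≤n k′) (λ e → Fin.<⇒≢ j<k (injectiveˡ π (U-injective e)))
        (⊠-injective (trans (embed (U j′) (V i) (U i′) (V k) (U k′) (V j)) (trans
          (collinear⇒balanced (wκ≈1 i) (wκ≈1 j) (wκ≈1 k) collinear)
          (sym (embed (U k′) (V i) (U j′) (V k) (U i′) (V j))))))
      where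
      i′ j′ k′ : Fin n
      i′ = π ⟨$⟩ˡ i
      j′ = π ⟨$⟩ˡ j
      k′ = π ⟨$⟩ˡ k

      wκ≈1 : ∀ i → (u (π ⟨$⟩ˡ i) + v i) * κ (π ⟨$⟩ˡ i) i ≈ 1#
      wκ≈1 i = proj₂ (proj₂ (reciprocal (π ⟨$⟩ˡ i) i))

      embed : ∀ x x′ y y′ z z′ → (x ℕ.* x′ ℕ.+ (y ℕ.* y′ ℕ.+ z ℕ.* z′)) ⊠ 1# ≈
              x ⊠ 1# * (x′ ⊠ 1#) + (y ⊠ 1# * (y′ ⊠ 1#) + z ⊠ 1# * (z′ ⊠ 1#))
      embed x x′ y y′ z z′ = trans (×-homo-+ 1# (x ℕ.* x′) (y ℕ.* y′ ℕ.+ z ℕ.* z′))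
        (+-cong (×1-homo-* x x′) (trans (×-homo-+ 1# (y ℕ.* y′) (z ℕ.* z′))
          (+-cong (×1-homo-* y y′) (×1-homo-* z z′))))

    pt-noncollinear : ∀ {i j k} → i ≢ j → j ≢ k → i ≢ k → ¬ Collinear (P i) (P j) (P k)
    pt-noncollinear {i} {j} {k} i≢j j≢k i≢k e with Fin.<-cmp i j | Fin.<-cmp j k | Fin.<-cmp i k
    ... | tri≈ _ i≡j _ | _            | _            = i≢j i≡j
    ... | tri< _ _ _   | tri≈ _ j≡k _ | _            = j≢k j≡k
    ... | tri> _ _ _   | tri≈ _ j≡k _ | _            = j≢k j≡k
    ... | tri< i<j _ _ | tri< j<k _ _ | _            = sorted-noncollinear i<j j<k e
    ... | tri> _ _ j<i | tri> _ _ k<j | _            = sorted-noncollinear k<j j<i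
      (collinear-swapˡ (P j) (P k) (P i) (collinear-swapʳ (P j) (P i) (P k) (collinear-swapˡ (P i) (P j) (P k) e)))
    ... | tri< i<j _ _ | tri> _ _ k<j | tri< i<k _ _ = sorted-noncollinear i<k k<j (collinear-swapʳ (P i) (P j) (P k) e)
    ... | tri< i<j _ _ | tri> _ _ k<j | tri≈ _ i≡k _ = i≢k i≡k
    ... | tri< i<j _ _ | tri> _ _ k<j | tri> _ _ k<i = sorted-noncollinear k<i i<j
      (collinear-swapˡ (P i) (P k) (P j) (collinear-swapʳ (P i) (P j) (P k) e))
    ... | tri> _ _ j<i | tri< j<k _ _ | tri< i<k _ _ = sorted-noncollinear j<i i<k (collinear-swapˡ (P i) (P j) (P k) e)
    ... | tri> _ _ j<i | tri< j<k _ _ | tri≈ _ i≡k _ = i≢k i≡k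
    ... | tri> _ _ j<i | tri< j<k _ _ | tri> _ _ k<i = sorted-noncollinear j<k k<i
      (collinear-swapʳ (P j) (P i) (P k) (collinear-swapˡ (P i) (P j) (P k) e))

    no-three-collinear : ∀ {x y z} → x ≢ y → y ≢ z → x ≢ z → ¬ Collinear (pos x) (pos y) (pos z)
    no-three-collinear {a}    {a}    {_}    x≢y y≢z x≢z _ = x≢y ≡.refl
    no-three-collinear {a}    {b}    {a}    x≢y y≢z x≢z _ = x≢z ≡.refl
    no-three-collinear {a}    {b}    {b}    x≢y y≢z x≢z _ = y≢z ≡.refl
    no-three-collinear {a}    {b}    {pt k} x≢y y≢z x≢z e = ab-noncollinear k e
    no-three-collinear {a}    {pt j} {a}    x≢y y≢z x≢z _ = x≢z ≡.refl
    no-three-collinear {a}    {pt j} {b}    x≢y y≢z x≢z e = ab-noncollinear j (collinear-swapʳ A (P j) B e)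
    no-three-collinear {a}    {pt j} {pt k} x≢y y≢z x≢z e = a-noncollinear (y≢z ∘ ≡.cong pt) e
    no-three-collinear {b}    {b}    {_}    x≢y y≢z x≢z _ = x≢y ≡.refl
    no-three-collinear {b}    {a}    {a}    x≢y y≢z x≢z _ = y≢z ≡.refl
    no-three-collinear {b}    {a}    {b}    x≢y y≢z x≢z _ = x≢z ≡.refl
    no-three-collinear {b}    {a}    {pt k} x≢y y≢z x≢z e = ab-noncollinear k (collinear-swapˡ B A (P k) e)
    no-three-collinear {b}    {pt j} {a}    x≢y y≢z x≢z e =
      ab-noncollinear j (collinear-swapˡ B A (P j) (collinear-swapʳ B (P j) A e))
    no-three-collinear {b}    {pt j} {b}    x≢y y≢z x≢z _ = x≢z ≡.refl
    no-three-collinear {b}    {pt j} {pt k} x≢y y≢z x≢z e = b-noncollinear (y≢z ∘ ≡.cong pt) e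
    no-three-collinear {pt i} {a}    {a}    x≢y y≢z x≢z _ = y≢z ≡.refl
    no-three-collinear {pt i} {a}    {b}    x≢y y≢z x≢z e =
      ab-noncollinear i (collinear-swapʳ A (P i) B (collinear-swapˡ (P i) A B e))
    no-three-collinear {pt i} {a}    {pt k} x≢y y≢z x≢z e =
      a-noncollinear (x≢z ∘ ≡.cong pt) (collinear-swapˡ (P i) A (P k) e)
    no-three-collinear {pt i} {b}    {a}    x≢y y≢z x≢z e =
      ab-noncollinear i (collinear-swapˡ B A (P i) (collinear-swapʳ B (P i) A (collinear-swapˡ (P i) B A e)))
    no-three-collinear {pt i} {b}    {b}    x≢y y≢z x≢z _ = y≢z ≡.refl
    no-three-collinear {pt i} {b}    {pt k} x≢y y≢z x≢z e =
      b-noncollinear (x≢z ∘ ≡.cong pt) (collinear-swapˡ (P i) B (P k) e)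
    no-three-collinear {pt i} {pt j} {a}    x≢y y≢z x≢z e = a-noncollinear (x≢y ∘ ≡.cong pt)
      (collinear-swapˡ (P i) A (P j) (collinear-swapʳ (P i) (P j) A e))
    no-three-collinear {pt i} {pt j} {b}    x≢y y≢z x≢z e = b-noncollinear (x≢y ∘ ≡.cong pt)
      (collinear-swapˡ (P i) B (P j) (collinear-swapʳ (P i) (P j) B e))
    no-three-collinear {pt i} {pt j} {pt k} x≢y y≢z x≢z e =
      pt-noncollinear (x≢y ∘ ≡.cong pt) (y≢z ∘ ≡.cong pt) (x≢z ∘ ≡.cong pt) e

    -- Reduces injectivity of `pos` to noncollinearity: two coinciding points would be collinear
    -- with any third vertex.
    coincident⇒collinear : ∀ p q r → p ≈ᵖ q → Collinear r p q
    coincident⇒collinear p q r p≈q = trans (det-cong (-ᵖ-cong p≈q ≈ᵖ-refl) ≈ᵖ-refl) (det-self (q -ᵖ r))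

    pos-injective : ∀ {x y} → pos x ≈ᵖ pos y → x ≡ y
    pos-injective {a}    {a}    _  = ≡.refl
    pos-injective {a}    {b}    (0≈1 , _)  = contradiction 0<1 (<-irrefl 0≈1)
    pos-injective {a}    {pt j} e  = contradiction
      (collinear-swapˡ B A (P j) (coincident⇒collinear A (P j) B e)) (ab-noncollinear j)
    pos-injective {b}    {a}    (1≈0 , _)  = contradiction 0<1 (<-irrefl (sym 1≈0))
    pos-injective {b}    {b}    _  = ≡.refl
    pos-injective {b}    {pt j} e  = contradiction (coincident⇒collinear B (P j) A e) (ab-noncollinear j)
    pos-injective {pt i} {a}    e  = contradiction
      (collinear-swapˡ B A (P i) (coincident⇒collinear A (P i) B (≈ᵖ-sym e))) (ab-noncollinear i)
    pos-injective {pt i} {b}    e  = contradiction (coincident⇒collinear B (P i) A (≈ᵖ-sym e)) (ab-noncollinear i)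
    pos-injective {pt i} {pt j} e with i Fin.≟ j
    ... | yes ≡.refl = ≡.refl
    ... | no  i≢j    = contradiction (coincident⇒collinear (P i) (P j) A e) (a-noncollinear i≢j)

  realization : Realization π
  realization = record
    { geometricGraph = record
      { pos                 = pos
      ; pos-injective       = pos-injective
      ; no-three-collinear  = no-three-collinear
      ; no-three-concurrent = λ {e} {f} {g} ve vf vg e≁f f≁g e≁g (X , X∈e , X∈f , X∈g) →
          no-concurrence configuration e f g X (edgeView ve) (edgeView vf) (edgeView vg) e≁f f≁g e≁g X∈e X∈f X∈g
      }
    ; rayᵃ        = rayᵃ
    ; rayᵇ        = rayᵇ
    ; same-side   = RayConfiguration.same-side configuration
    ; increasingᵃ = RayConfiguration.increasingᵃ configuration
    ; increasingᵇ = RayConfiguration.increasingᵇ configuration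
    ; meet        = λ i j → crossroad i j , onRayᵃ i j , onRayᵇ i j
    ; placedᵃ     = RayConfiguration.placedᵃ configuration
    ; placedᵇ     = RayConfiguration.placedᵇ configuration
    }

-- Counting an orbit

≈ₚ-sym : ∀ {n} (σ π : Permutation′ n) → σ ≈ₚ π → π ≈ₚ σ
≈ₚ-sym σ π e i = ≡.sym (e i)

≈ₚ-trans : ∀ {n} (ρ σ π : Permutation′ n) → ρ ≈ₚ σ → σ ≈ₚ π → ρ ≈ₚ π
≈ₚ-trans ρ σ π e e′ i = ≡.trans (e i) (e′ i)

ʳ-cong : ∀ {n} (σ π : Permutation′ n) → σ ≈ₚ π → σ ʳ ≈ₚ π ʳ
ʳ-cong σ π e i = ≡.cong opposite (≈⇒≈ˡ σ π e (opposite i))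

ʳ-involutive : ∀ {n} (π : Permutation′ n) → π ʳ ʳ ≈ₚ π
ʳ-involutive π i = ≡.trans (Fin.opposite-involutive _) (≡.cong (π ⟨$⟩ʳ_) (Fin.opposite-involutive i))

-- flip and _ʳ are commuting involutions, and C is an orbit of the Klein four-group they generate.
module Orbit {n ℓ} {C : Pred (Permutation′ n) ℓ} (π : Permutation′ n)
             (C⇔ : ∀ σ → σ ∈ C ⇔ (σ ≈ₚ π ⊎ σ ≈ₚ flip π ⊎ σ ≈ₚ π ʳ ⊎ σ ≈ₚ flip (π ʳ))) where

  private
    π∈C : π ∈ C
    π∈C = from (C⇔ π) (inj₁ λ _ → ≡.refl)

    flip∈C : flip π ∈ C
    flip∈C = from (C⇔ (flip π)) (inj₂ (inj₁ λ _ → ≡.refl))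

    ʳ∈C : π ʳ ∈ C
    ʳ∈C = from (C⇔ (π ʳ)) (inj₂ (inj₂ (inj₁ λ _ → ≡.refl)))

    flip-ʳ∈C : flip (π ʳ) ∈ C
    flip-ʳ∈C = from (C⇔ (flip (π ʳ))) (inj₂ (inj₂ (inj₂ λ _ → ≡.refl)))

    covered : ∀ {k} (f : Fin k → Permutation′ n) →
              (∃[ i ] π ≈ₚ f i) → (∃[ i ] flip π ≈ₚ f i) → (∃[ i ] π ʳ ≈ₚ f i) → (∃[ i ] flip (π ʳ) ≈ₚ f i) →
              ∀ σ → σ ∈ C → ∃[ i ] σ ≈ₚ f i
    covered f (i₁ , e₁) (i₂ , e₂) (i₃ , e₃) (i₄ , e₄) σ σ∈C with to (C⇔ σ) σ∈C
    ... | inj₁ e               = i₁ , ≈ₚ-trans σ π (f i₁) e e₁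
    ... | inj₂ (inj₁ e)        = i₂ , ≈ₚ-trans σ (flip π) (f i₂) e e₂
    ... | inj₂ (inj₂ (inj₁ e)) = i₃ , ≈ₚ-trans σ (π ʳ) (f i₃) e e₃
    ... | inj₂ (inj₂ (inj₂ e)) = i₄ , ≈ₚ-trans σ (flip (π ʳ)) (f i₄) e e₄

    pair : ∀ ρ → ρ ∈ C → ¬ π ≈ₚ ρ → (flip π ≈ₚ π ⊎ flip π ≈ₚ ρ) → (π ʳ ≈ₚ π ⊎ π ʳ ≈ₚ ρ) →
           (flip (π ʳ) ≈ₚ π ⊎ flip (π ʳ) ≈ₚ ρ) → HasCardinality C 2
    pair ρ ρ∈C π≉ρ p q r = f , (λ { 0F → π∈C ; 1F → ρ∈C }) , f-injective
      , covered f (0F , λ _ → ≡.refl) (index (flip π) p) (index (π ʳ) q) (index (flip (π ʳ)) r)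
      where
      f : Fin 2 → Permutation′ n
      f 0F = π
      f 1F = ρ

      f-injective : ∀ {i j} → f i ≈ₚ f j → i ≡ j
      f-injective {0F} {0F} _ = ≡.refl
      f-injective {0F} {1F} e = contradiction e π≉ρ
      f-injective {1F} {0F} e = contradiction (≈ₚ-sym ρ π e) π≉ρ
      f-injective {1F} {1F} _ = ≡.refl

      index : ∀ (σ : Permutation′ n) → σ ≈ₚ π ⊎ σ ≈ₚ ρ → ∃[ i ] σ ≈ₚ f i
      index σ (inj₁ e) = 0F , e
      index σ (inj₂ e) = 1F , e

  cardinality-1 : π ≈ₚ flip π → π ≈ₚ π ʳ → HasCardinality C 1
  cardinality-1 e₁ e₂ = (λ _ → π) , (λ _ → π∈C) , (λ { {0F} {0F} _ → ≡.refl })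
    , covered (λ _ → π) (0F , λ _ → ≡.refl) (0F , ≈ₚ-sym π (flip π) e₁) (0F , ≈ₚ-sym π (π ʳ) e₂)
      (0F , ≈ₚ-trans (flip (π ʳ)) (flip π) π (≈⇒≈ˡ (π ʳ) π (≈ₚ-sym π (π ʳ) e₂)) (≈ₚ-sym π (flip π) e₁))

  cardinality-2ᶠ : π ≈ₚ flip π → ¬ π ≈ₚ π ʳ → HasCardinality C 2
  cardinality-2ᶠ e₁ ¬e₂ = pair (π ʳ) ʳ∈C ¬e₂ (inj₁ (≈ₚ-sym π (flip π) e₁)) (inj₂ λ _ → ≡.refl)
    (inj₂ (≈ₚ-sym (π ʳ) (flip (π ʳ)) (ʳ-cong π (flip π) e₁)))

  cardinality-2ʳ : ¬ π ≈ₚ flip π → π ≈ₚ π ʳ → HasCardinality C 2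
  cardinality-2ʳ ¬e₁ e₂ = pair (flip π) flip∈C ¬e₁ (inj₂ λ _ → ≡.refl) (inj₁ (≈ₚ-sym π (π ʳ) e₂))
    (inj₂ (≈⇒≈ˡ (π ʳ) π (≈ₚ-sym π (π ʳ) e₂)))

  cardinality-2ᶠʳ : ¬ π ≈ₚ flip π → π ≈ₚ flip (π ʳ) → HasCardinality C 2
  cardinality-2ᶠʳ ¬e₁ e₃ = pair (flip π) flip∈C ¬e₁ (inj₂ λ _ → ≡.refl)
    (inj₂ (≈ₚ-sym (flip π) (π ʳ) (≈⇒≈ˡ π (flip (π ʳ)) e₃))) (inj₁ (≈ₚ-sym π (flip (π ʳ)) e₃))

  cardinality-4 : ¬ π ≈ₚ flip π → ¬ π ≈ₚ π ʳ → ¬ π ≈ₚ flip (π ʳ) → HasCardinality C 4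
  cardinality-4 ¬e₁ ¬e₂ ¬e₃ = f , (λ { 0F → π∈C ; 1F → flip∈C ; 2F → ʳ∈C ; 3F → flip-ʳ∈C }) , f-injective
    , covered f (0F , λ _ → ≡.refl) (1F , λ _ → ≡.refl) (2F , λ _ → ≡.refl) (3F , λ _ → ≡.refl)
    where
    f : Fin 4 → Permutation′ n
    f 0F = π
    f 1F = flip π
    f 2F = π ʳ
    f 3F = flip (π ʳ)

    f-injective< : ∀ {i j} → i < j → ¬ f i ≈ₚ f j
    f-injective< {0F} {1F} _ = ¬e₁
    f-injective< {0F} {2F} _ = ¬e₂
    f-injective< {0F} {3F} _ = ¬e₃
    f-injective< {1F} {2F} _ = ¬e₃ ∘ ≈⇒≈ˡ (flip π) (π ʳ)
    f-injective< {1F} {3F} _ = ¬e₂ ∘ ≈⇒≈ˡ (flip π) (flip (π ʳ))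
    -- Applying `_ʳ` to both sides leads back to `π` and `flip π`; that `flip` and `_ʳ` commute
    -- holds by computation.
    f-injective< {2F} {3F} _ e = ¬e₁ λ i → ≡.trans (≡.sym (ʳ-involutive π i))
      (≡.trans (ʳ-cong (π ʳ) (flip (π ʳ)) e i) (ʳ-involutive (flip π) i))
    f-injective< {1F} {1F} (s≤s ())
    f-injective< {2F} {1F} (s≤s ())
    f-injective< {2F} {2F} (s≤s (s≤s ()))
    f-injective< {3F} {1F} (s≤s ())
    f-injective< {3F} {2F} (s≤s (s≤s ()))
    f-injective< {3F} {3F} (s≤s (s≤s (s≤s ())))

    f-injective : ∀ {i j} → f i ≈ₚ f j → i ≡ j
    f-injective {i} {j} e with Fin.<-cmp i j
    ... | tri< i<j _ _ = contradiction e (f-injective< i<j)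
    ... | tri≈ _ i≡j _ = i≡j
    ... | tri> _ _ j<i = contradiction (≈ₚ-sym (f i) (f j) e) (f-injective< j<i)

  -- The cases are the possible stabilisers of `π` in the Klein four-group: the whole group, the
  -- three subgroups of order two, and the trivial one.
  cardinality : HasCardinality C 4 ⊎ HasCardinality C 2 ⊎ HasCardinality C 1
  cardinality with π ≈ₚ? flip π | π ≈ₚ? π ʳ | π ≈ₚ? flip (π ʳ)
  ... | yes e₁ | yes e₂ | _      = inj₂ (inj₂ (cardinality-1 e₁ e₂))
  ... | yes e₁ | no ¬e₂ | _      = inj₂ (inj₁ (cardinality-2ᶠ e₁ ¬e₂))
  ... | no ¬e₁ | yes e₂ | _      = inj₂ (inj₁ (cardinality-2ʳ ¬e₁ e₂))
  ... | no ¬e₁ | no ¬e₂ | yes e₃ = inj₂ (inj₁ (cardinality-2ᶠʳ ¬e₁ e₃))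
  ... | no ¬e₁ | no ¬e₂ | no ¬e₃ = inj₁ (cardinality-4 ¬e₁ ¬e₂ ¬e₃)

-- Examples

module _ {n} {G : SimpleGraph (Fin n)} (adj? : Decidable (Adj G)) where

  isModule? : ∀ M → Dec (IsModule G M)
  isModule? M = nonempty? M ×-dec Fin.all? λ v → ¬? (v ∈? M) →-dec
    (Fin.all? (λ m → (m ∈? M) →-dec adj? v m) ⊎-dec Fin.all? (λ m → (m ∈? M) →-dec ¬? (adj? v m)))

  isTrivial? : ∀ (M : Subset n) → Dec (M ≡ Subset.⊤ ⊎ (∃[ v ] M ≡ Subset.⁅ v ⁆))
  isTrivial? M = Vec.≡-dec Bool._≟_ M Subset.⊤ ⊎-dec Fin.any? λ v → Vec.≡-dec Bool._≟_ M Subset.⁅ v ⁆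

  -- A search through all subsets for a nontrivial module; since triviality is decidable, a failed
  -- search yields the universal statement.
  onlyTrivialModules? : Dec (OnlyTrivialModules G)
  onlyTrivialModules? = map′
    (λ none M M-module → decidable-stable (isTrivial? M) λ ¬trivial → none (M , M-module , ¬trivial))
    (λ trivial (M , M-module , ¬trivial) → ¬trivial (trivial M M-module))
    (¬? (anySubset? λ M → isModule? M ×-dec ¬? (isTrivial? M)))

  connected? : Dec (Connected G)
  connected? = Fin.all? λ u → Fin.all? λ v → star? adj? u v

isPrimeRoot? : ∀ {n} {G : SimpleGraph (Fin n)} → Decidable (Adj G) → Dec (IsPrimeRoot G)
isPrimeRoot? {n} {G} adj? = (1 ℕ.<? n) ×-dec connected? {G = G} adj? ×-dec connected? {G = complement G}
  λ u v → ¬? (u Fin.≟ v) ×-dec ¬? (adj? u v)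

tabulated : ∀ {n} (xs ys : Vec (Fin n) n) →
            {True (Fin.all? λ i → lookup xs (lookup ys i) Fin.≟ i)} →
            {True (Fin.all? λ i → lookup ys (lookup xs i) Fin.≟ i)} → Permutation′ n
tabulated xs ys {p} {q} = permutation (lookup xs) (lookup ys) (toWitness p) (toWitness q)

-- The class of πₖ has k elements. Tables are 0-based and list π followed by its inverse.
π₁ π₄ : Permutation′ 6
π₁ = tabulated (2F ∷ 4F ∷ 0F ∷ 5F ∷ 1F ∷ 3F ∷ []) (2F ∷ 4F ∷ 0F ∷ 5F ∷ 1F ∷ 3F ∷ [])
π₄ = tabulated (1F ∷ 3F ∷ 5F ∷ 0F ∷ 4F ∷ 2F ∷ []) (3F ∷ 0F ∷ 5F ∷ 1F ∷ 4F ∷ 2F ∷ [])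

π₂ : Permutation′ 4
π₂ = tabulated (1F ∷ 3F ∷ 0F ∷ 2F ∷ []) (2F ∷ 0F ∷ 3F ∷ 1F ∷ [])

π₁-trivial : OnlyTrivialModules G⟨ π₁ ⟩
π₁-trivial = from-yes (onlyTrivialModules? {G = G⟨ π₁ ⟩} (adj? π₁))

π₂-trivial : OnlyTrivialModules G⟨ π₂ ⟩
π₂-trivial = from-yes (onlyTrivialModules? {G = G⟨ π₂ ⟩} (adj? π₂))

π₄-trivial : OnlyTrivialModules G⟨ π₄ ⟩
π₄-trivial = from-yes (onlyTrivialModules? {G = G⟨ π₄ ⟩} (adj? π₄))

π₁-root : IsPrimeRoot G⟨ π₁ ⟩
π₁-root = from-yes (isPrimeRoot? {G = G⟨ π₁ ⟩} (adj? π₁))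

π₂-root : IsPrimeRoot G⟨ π₂ ⟩
π₂-root = from-yes (isPrimeRoot? {G = G⟨ π₂ ⟩} (adj? π₂))

π₄-root : IsPrimeRoot G⟨ π₄ ⟩
π₄-root = from-yes (isPrimeRoot? {G = G⟨ π₄ ⟩} (adj? π₄))

-- The geo-equivalence class of a prime permutation

module GeoEquivalenceClass {c ℓ₁ ℓ₂} (𝔽 : OrderedField c ℓ₁ ℓ₂) where
  open Geometry 𝔽
  open GeoEquivalence 𝔽
  open Construction 𝔽 using (realization)

  ≅±⇒∼ : ∀ {n} (σ π : Permutation′ n) → σ ≅± π → σ ∼ π
  ≅±⇒∼ σ π i = realization σ , realization π , ≅±⇒geoIso (realization σ) (realization π) i

  module _ {n} (π : Permutation′ n) (trivial-modules : OnlyTrivialModules G⟨ π ⟩) (root : IsPrimeRoot G⟨ π ⟩) where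
    open Prime {π = π} trivial-modules root

    class⇔ : ∀ σ → σ ∈ [ π ] ⇔ (σ ≈ₚ π ⊎ σ ≈ₚ flip π ⊎ σ ≈ₚ π ʳ ⊎ σ ≈ₚ flip (π ʳ))
    class⇔ σ = mk⇔ (≅±⇒≈ {σ} ∘ ∼⇒≅± 3≤n) (≅±⇒∼ σ π ∘ class⇒≅± {σ = σ} {π})

    ≅±⇒≐ : ∀ σ → σ ≅± π → [ σ ] ≐ [ π ]
    ≅±⇒≐ σ σ≅π =
      (λ {ρ} ρ∼σ → ≅±⇒∼ ρ π (≅±-trans ρ σ π (∼⇒≅± 3≤n ρ∼σ) σ≅π)) ,
      (λ {ρ} ρ∼π → ≅±⇒∼ ρ σ (≅±-trans ρ π σ (∼⇒≅± 3≤n ρ∼π) (≅±-sym σ π σ≅π)))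

    -- A transitive orientation of `G⟨ π ⟩` is `D π` or its reverse, so every permutation `τ` that
    -- it represents satisfies `τ ≅± π` and has the class of `π`. Conversely, `D π` is itself such
    -- an orientation and represents `π`.
    represented⇔ : ∀ σ → (∃₂ λ (F : Digraph n) (_ : IsTransitiveOrientation G⟨ π ⟩ F) → F RepresentsClass [ σ ])
                         ⇔ ([ σ ] ≐ [ π ])
    represented⇔ σ = mk⇔
      (λ { (F , F-to , τ , τ∼σ , F≅τ) → ≅±⇒≐ σ
        (≅±-trans σ τ π (≅±-sym τ σ (∼⇒≅± 3≤n τ∼σ)) (τ≅±π F τ F≅τ (orientation-unique F-to))) })
      (λ (_ , [π]⊆[σ]) → D π , E-orientation π , π , [π]⊆[σ] (≅±⇒∼ π π (≅±-refl π)) , ≅ᵈ-refl (D π))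
      where
      τ≅±π : ∀ F τ → F ≅ᵈ D τ → F ≅ᵈ D π ⊎ F ≅ᵈ (D π ᵒ) → τ ≅± π
      τ≅±π F τ F≅τ = Sum.map (≅ᵈ-trans (D τ) F (D π) (≅ᵈ-sym F (D τ) F≅τ)) (≅ᵈ-trans (D τ) F (D π ᵒ) (≅ᵈ-sym F (D τ) F≅τ))

    module Class = Orbit {C = [ π ]} π class⇔

  example : ∀ k → k ≡ 4 ⊎ k ≡ 2 ⊎ k ≡ 1 →
            ∃₂ λ (n : ℕ) (π : Permutation′ n) → OnlyTrivialModules G⟨ π ⟩ × IsPrimeRoot G⟨ π ⟩ × HasCardinality [ π ] k
  example _ (inj₁ ≡.refl)        = 6 , π₄ , π₄-trivial , π₄-root , Class.cardinality-4 π₄ π₄-trivial π₄-root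
    (from-no (π₄ ≈ₚ? flip π₄)) (from-no (π₄ ≈ₚ? π₄ ʳ)) (from-no (π₄ ≈ₚ? flip (π₄ ʳ)))
  example _ (inj₂ (inj₁ ≡.refl)) = 4 , π₂ , π₂-trivial , π₂-root , Class.cardinality-2ᶠʳ π₂ π₂-trivial π₂-root
    (from-no (π₂ ≈ₚ? flip π₂)) (from-yes (π₂ ≈ₚ? flip (π₂ ʳ)))
  example _ (inj₂ (inj₂ ≡.refl)) = 6 , π₁ , π₁-trivial , π₁-root , Class.cardinality-1 π₁ π₁-trivial π₁-root
    (from-yes (π₁ ≈ₚ? flip π₁)) (from-yes (π₁ ≈ₚ? π₁ ʳ))

open import Data.Fin.Permutation using (_≈_)

proposition4 : ∀ {c ℓ₁ ℓ₂ : Level} (𝔽 : OrderedField c ℓ₁ ℓ₂) →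
    let open Geometry 𝔽 in
    (∀ (n : ℕ) (π : Permutation′ n) →
    OnlyTrivialModules G⟨ π ⟩ → IsPrimeRoot G⟨ π ⟩ →
    (∀ (σ : Permutation′ n) →
    σ ∈ [ π ] ⇔
    (σ ≈ π ⊎ σ ≈ flip π ⊎ σ ≈ (flip (π ᶜ)) ᶜ ⊎ σ ≈ flip ((flip (π ᶜ)) ᶜ)))
    × (HasCardinality [ π ] 4 ⊎ HasCardinality [ π ] 2 ⊎ HasCardinality [ π ] 1)
    × (∀ (σ : Permutation′ n) →
    (∃₂ λ (F : Digraph n) (_ : IsTransitiveOrientation G⟨ π ⟩ F) → F RepresentsClass [ σ ])
    ⇔ ([ σ ] ≐ [ π ])))
    × (∀ (k : ℕ) → k ≡ 4 ⊎ k ≡ 2 ⊎ k ≡ 1 →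
    ∃₂ λ (n : ℕ) (π : Permutation′ n) →
    OnlyTrivialModules G⟨ π ⟩ × IsPrimeRoot G⟨ π ⟩ × HasCardinality [ π ] k)
proposition4 𝔽 =
  (λ n π trivial-modules root →
    class⇔ π trivial-modules root , Class.cardinality π trivial-modules root , represented⇔ π trivial-modules root) ,
  example
  where open GeoEquivalenceClass 𝔽
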